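{- Let $n \in \mathbb{Z}^+$, let $(u,v)$ be drawn uniformly at random from $\mathcal{P}_n \times \mathcal{P}_n$, and let $\mathsf{\Phi}_{n,n} = \Phi_n(u\cdot v)$. Then \[ \mathbb{E}\{\mathsf{\Phi}_{n,n}\} = (n+1)(1 + O(1/q)) \quad\text{and}\quad \mathrm{Var}\{\mathsf{\Phi}_{n,n}\} = O(n^4), \] where the constants hidden in the $O(\cdot)$ terms are absolute and independent of $q$ and $n$.
   Context: $\mathbb{F}$ is a finite field with $q$ elements. $\mathcal{P}_n$ is the set of monic polynomials in $\mathbb{F}[x]$ of degree at most $n$. For $s \in \mathcal{P}_{2n}$, $\Phi_n(s)$ is the number of ordered pairs $(u',v') \in \mathcal{P}_n\times\mathcal{P}_n$ with $s = u'\cdot v'$. -}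

module Defs where

open import Data.Nat using (ℕ; zero; suc)
import Data.Nat as ℕ
open import Data.Fin using (Fin)
import Data.Fin.Properties as FinP
open import Data.List using (List; []; _∷_; _++_; map; concatMap; upTo; length; filter; cartesianProduct; allFin)
open import Data.Nat.ListAction using (sum)
import Data.List.Properties as ListP
open import Data.Product using (Σ; _×_; _,_; proj₁; proj₂)
open import Data.Integer using (+_)
open import Data.Rational using (ℚ; _/_; _-_; _*_)
open import Function.Bundles using (_↔_; Inverse)
open import Relation.Binary.PropositionalEquality using (_≡_; _≢_; cong; trans; sym)
open import Relation.Binary.Definitions using (DecidableEquality)
open import Relation.Nullary using (yes; no)
open import Algebra.Structures using (IsCommutativeRing)

record FiniteField : Set₁ where
  infixl 6 _+_
  infixl 7 _·_
  field
    Carrier : Set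
    _+_ _·_ : Carrier → Carrier → Carrier
    -_ : Carrier → Carrier
    0# 1# : Carrier
    isCommutativeRing : IsCommutativeRing _≡_ _+_ _·_ -_ 0# 1#
    0≢1 : 0# ≢ 1#
    inverse : ∀ x → x ≢ 0# → Σ Carrier (λ y → x · y ≡ 1#)
    q : ℕ
    enum : Fin q ↔ Carrier

ℕ→ℚ : ℕ → ℚ
ℕ→ℚ k = (+ k) / 1

module _ (F : FiniteField) where
  open FiniteField F
  open Inverse enum

  _≟F_ : DecidableEquality Carrier
  x ≟F y with FinP._≟_ (from x) (from y)
  ... | yes p = yes (trans (sym (strictlyInverseˡ x)) (trans (cong to p) (strictlyInverseˡ y)))
  ... | no ¬p = no (λ e → ¬p (cong from e))

  -- Polynomials over F are coefficient lists, lowest degree first.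
  Poly : Set
  Poly = List Carrier

  addP : Poly → Poly → Poly
  addP [] g = g
  addP (a ∷ f) [] = a ∷ f
  addP (a ∷ f) (b ∷ g) = (a + b) ∷ addP f g

  mulP : Poly → Poly → Poly
  mulP [] g = []
  mulP (a ∷ f) g = addP (map (a ·_) g) (0# ∷ mulP f g)

  elems : List Carrier
  elems = map to (allFin q)

  allVecs : ℕ → List Poly
  allVecs zero = [] ∷ []
  allVecs (suc d) = concatMap (λ x → map (x ∷_) (allVecs d)) elems

  -- 𝒫_n : all monic polynomials of degree at most n (each listed once;
  -- a monic polynomial of degree d is its d lower coefficients followed by 1)
  monics : ℕ → List Poly
  monics n = concatMap (λ d → map (λ v → v ++ (1# ∷ [])) (allVecs d)) (upTo (suc n))

  -- Φ_n(s) = #{ (u',v') ∈ 𝒫_n × 𝒫_n : s = u'·v' }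
  -- (monic polynomials have nonzero leading coefficient, so their products
  -- are in canonical form and list equality is polynomial equality)
  Φ : ℕ → Poly → ℕ
  Φ n s = length (filter (λ p → ListP.≡-dec _≟F_ s (mulP (proj₁ p) (proj₂ p)))
                         (cartesianProduct (monics n) (monics n)))

  pairs : ℕ → List (Poly × Poly)
  pairs n = cartesianProduct (monics n) (monics n)

  N² : ℕ → ℕ
  N² n = length (monics n) ℕ.* length (monics n)

  expectΦ : ℕ → ℚ
  expectΦ n = (+ sum (map (λ p → Φ n (mulP (proj₁ p) (proj₂ p))) (pairs n))) / N² n

  expectΦ² : ℕ → ℚ
  expectΦ² n = (+ sum (map (λ p → let k = Φ n (mulP (proj₁ p) (proj₂ p)) in k ℕ.* k) (pairs n))) / N² n

  varΦ : ℕ → ℚ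
  varΦ n = expectΦ² n - expectΦ n * expectΦ n

{-# OPTIONS --safe #-}
module Submission where

-- A solution of u v = u′ v′ in monic polynomials is u = g a, v = b h, u′ = g b, v′ = a h, uniquely so
-- if a and b are coprime. Grouping by m = max (deg a, deg b), the number of (g, h) is the square of
-- the number of monic polynomials of degree ≤ n - m, and the number of (a, b) is about q^2m; hence
-- each m ≤ n contributes |𝒫_n|² (1 + O(1/q)) to Σ Φ. For the upper bound coprimality is dropped;
-- for the lower bound only pairs with deg a = deg b are kept, nearly all of which are coprime.
-- Existence of the parametrisation is proved by Euclid's algorithm on (u, u′), and its uniqueness
-- follows by applying existence once more.
--
-- The variance is at most the second moment, which counts solutions of u v = u′ v′ = u″ v″. These
-- have a common refinement into eight factors; their degrees have four degrees of freedom once those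
-- of u, v, u′, u″ are known, and the defects n - deg u, n - deg v cost a factor q each per unit.

open import Defs
open import Data.Nat using (ℕ; zero; suc; _∸_; _≤_; _<_; _^_; z≤n; s≤s)
import Data.Nat as ℕ
import Data.Nat.Properties as ℕ
open import Data.Nat.ListAction using (sum)
open import Data.Nat.ListAction.Properties using (sum-++)
open import Data.Nat.Tactic.RingSolver using () renaming (solve-∀ to ℕ-solve-∀)
import Data.Integer as ℤ
import Data.Integer.Properties as ℤ
import Data.Rational as ℚ
import Data.Rational.Properties as ℚ
import Data.Rational.Unnormalised as ℚᵘ
import Data.Rational.Unnormalised.Properties as ℚᵘ
open import Data.Fin using (Fin; zero)
open import Data.List
  using (List; []; _∷_; _++_; _∷ʳ_; map; concatMap; length; filter; upTo; allFin;
         cartesianProduct; cartesianProductWith)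
open import Data.List.Properties using (length-map; length-++)
import Data.List.Properties as List
open import Data.List.Membership.Propositional using (_∈_; _∉_; find; lose)
open import Data.List.Membership.Propositional.Properties
import Data.List.Membership.DecPropositional as DecMembership
import Data.List.Relation.Unary.All as All
open import Data.List.Relation.Unary.AllPairs using ([]; _∷_)
open import Data.List.Relation.Unary.Any using (here; there)
open import Data.List.Relation.Unary.Unique.Propositional using (Unique)
import Data.List.Relation.Unary.Unique.Propositional.Properties as Unique
open import Data.Vec as Vec using (Vec; []; _∷_)
open import Data.Empty using (⊥-elim)
open import Data.Product using (_×_; _,_; proj₁; proj₂; ∃-syntax)
import Data.Product.Properties as Product
open import Data.Sum using (_⊎_; inj₁; inj₂)
open import Function using (_∘_)
open import Function.Bundles using (Inverse)
open import Algebra.Bundles using (CommutativeRing)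
import Algebra.Properties.Ring as RingProperties
import Algebra.Solver.Ring.NaturalCoefficients.Default as SemiringSolver
open import Relation.Binary.Definitions using (DecidableEquality; tri<; tri≈; tri>)
open import Relation.Binary.PropositionalEquality
  using (_≡_; _≢_; refl; sym; trans; cong; cong₂; subst; module ≡-Reasoning)
import Relation.Binary.Reasoning.Setoid as SetoidReasoning
open import Relation.Nullary using (yes; no; ¬_; ¬?)
open import Relation.Unary using (Decidable)

-- Unique factorisation and gcds are never set up: whatever is needed about divisibility is a
-- refinement of an equation between products. Counting is done by `length-≤`, in two opposite ways.
-- For upper bounds every solution must come from some parameter, and repetitions among the
-- parameters are harmless; for the lower bound distinct parameters must give distinct solutions,
-- and only there is coprimality used. Estimates are multiplied by q or by `p` = q - 1 so that they
-- stay in ℕ. The 4 in the expectation serves both sides: q(q+1) ≤ (q-1)(q+4) for q ≥ 2 above, and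
-- four losses of |𝒫_n|²/q for each degree below. The 2304 is 12² · 2⁴: the sum of (1+x)² q^(-x)
-- over the defects x is at most 12, it occurs once for u and once for v, and n+1 ≤ 2n turns (n+1)⁴
-- into 16 n⁴.

-- The ring of polynomials over F, up to trailing zeros.

module Polynomials (F : FiniteField) where
  open FiniteField F

  𝔽 : CommutativeRing _ _
  𝔽 = record { isCommutativeRing = isCommutativeRing }

  module 𝔽-Solver = SemiringSolver (CommutativeRing.commutativeSemiring 𝔽)

  open CommutativeRing 𝔽 using (zeroˡ; zeroʳ; *-identityˡ; *-identityʳ; +-identityˡ; +-identityʳ)

  infixl 6 _⊞_
  infixl 7 _⊠_
  infixr 7 _⊙_
  infix  4 _≈_

  _⊞_ _⊠_ : Poly F → Poly F → Poly F
  _⊞_ = addP F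
  _⊠_ = mulP F

  _⊙_ : Carrier → Poly F → Poly F
  a ⊙ f = map (a ·_) f

  coef : Poly F → ℕ → Carrier
  coef []      _       = 0#
  coef (a ∷ f) zero    = a
  coef (a ∷ f) (suc k) = coef f k

  -- Lists that differ by trailing zeros denote the same polynomial, and subtraction produces them,
  -- so the ring laws are stated up to this relation. The record wrapper keeps `f` and `g` inferable
  -- from the type.
  record _≈_ (f g : Poly F) : Set where
    constructor coefs
    field at : ∀ k → coef f k ≡ coef g k
  open _≈_

  coef-⊞ : ∀ f g k → coef (f ⊞ g) k ≡ coef f k + coef g k
  coef-⊞ []      g       k       = sym (+-identityˡ _)
  coef-⊞ (a ∷ f) []      k       = sym (+-identityʳ _)
  coef-⊞ (a ∷ f) (b ∷ g) zero    = refl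
  coef-⊞ (a ∷ f) (b ∷ g) (suc k) = coef-⊞ f g k

  coef-⊙ : ∀ a f k → coef (a ⊙ f) k ≡ a · coef f k
  coef-⊙ a []      k       = sym (zeroʳ a)
  coef-⊙ a (b ∷ f) zero    = refl
  coef-⊙ a (b ∷ f) (suc k) = coef-⊙ a f k

  ≈-refl : ∀ {f} → f ≈ f
  ≈-refl .at k = refl

  ≈-sym : ∀ {f g} → f ≈ g → g ≈ f
  ≈-sym p .at k = sym (p .at k)

  ≈-trans : ∀ {f g h} → f ≈ g → g ≈ h → f ≈ h
  ≈-trans p q .at k = trans (p .at k) (q .at k)

  ≡⇒≈ : ∀ {f g} → f ≡ g → f ≈ g
  ≡⇒≈ refl = ≈-refl

  ⊞-cong : ∀ {f f′ g g′} → f ≈ f′ → g ≈ g′ → f ⊞ g ≈ f′ ⊞ g′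
  ⊞-cong {f} {f′} {g} {g′} p q .at k =
    trans (coef-⊞ f g k) (trans (cong₂ _+_ (p .at k) (q .at k)) (sym (coef-⊞ f′ g′ k)))

  ⊙-cong : ∀ {a f g} → f ≈ g → a ⊙ f ≈ a ⊙ g
  ⊙-cong {a} {f} {g} p .at k =
    trans (coef-⊙ a f k) (trans (cong (a ·_) (p .at k)) (sym (coef-⊙ a g k)))

  ∷-cong : ∀ {a f g} → f ≈ g → a ∷ f ≈ a ∷ g
  ∷-cong p .at zero    = refl
  ∷-cong p .at (suc k) = p .at k

  ⊞-assoc : ∀ f g h → (f ⊞ g) ⊞ h ≈ f ⊞ (g ⊞ h)
  ⊞-assoc f g h .at k
    rewrite coef-⊞ (f ⊞ g) h k | coef-⊞ f g k | coef-⊞ f (g ⊞ h) k | coef-⊞ g h k =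
    CommutativeRing.+-assoc 𝔽 _ _ _

  ⊞-comm : ∀ f g → f ⊞ g ≈ g ⊞ f
  ⊞-comm f g .at k rewrite coef-⊞ f g k | coef-⊞ g f k = CommutativeRing.+-comm 𝔽 _ _

  ⊟_ : Poly F → Poly F
  ⊟ f = (- 1#) ⊙ f

  ⊟-inverseʳ : ∀ f → f ⊞ ⊟ f ≈ []
  ⊟-inverseʳ f .at k rewrite coef-⊞ f (⊟ f) k | coef-⊙ (- 1#) f k = 
    trans (cong (coef f k +_) (RingProperties.-1*x≈-x (CommutativeRing.ring 𝔽) _))
          (CommutativeRing.-‿inverseʳ 𝔽 _)

  ⊞-identityʳ : ∀ f → f ⊞ [] ≈ f
  ⊞-identityʳ []      = ≈-refl
  ⊞-identityʳ (a ∷ f) = ≈-refl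

  ⊠-zeroʳ : ∀ f → f ⊠ [] ≈ []
  ⊠-zeroʳ []      = ≈-refl
  ⊠-zeroʳ (a ∷ f) .at zero    = refl
  ⊠-zeroʳ (a ∷ f) .at (suc k) = ⊠-zeroʳ f .at k

  ⊠-congʳ : ∀ f {g h} → g ≈ h → f ⊠ g ≈ f ⊠ h
  ⊠-congʳ []      p = ≈-refl
  ⊠-congʳ (a ∷ f) p = ⊞-cong (⊙-cong p) (∷-cong (⊠-congʳ f p))

  -- `mulP` recurses on its left factor; this is the mirror recursion on the right one, from which
  -- commutativity follows by induction.
  ⊠-∷ : ∀ f b g → f ⊠ (b ∷ g) ≈ b ⊙ f ⊞ (0# ∷ f ⊠ g)
  ⊠-∷ []      b g .at zero    = refl
  ⊠-∷ []      b g .at (suc k) = refl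
  ⊠-∷ (a ∷ f) b g .at zero    = cong (_+ 0#) (CommutativeRing.*-comm 𝔽 a b)
  ⊠-∷ (a ∷ f) b g .at (suc k)
    rewrite coef-⊞ (a ⊙ g) (f ⊠ (b ∷ g)) k
          | ⊠-∷ f b g .at k
          | coef-⊞ (b ⊙ f) (0# ∷ f ⊠ g) k
          | coef-⊞ (b ⊙ f) (a ⊙ g ⊞ (0# ∷ f ⊠ g)) k
          | coef-⊞ (a ⊙ g) (0# ∷ f ⊠ g) k = 
    solve 3 (λ x y z → x :+ (y :+ z) := y :+ (x :+ z)) refl _ _ _
    where open 𝔽-Solver

  ⊠-comm : ∀ f g → f ⊠ g ≈ g ⊠ f
  ⊠-comm []      g = ≈-sym (⊠-zeroʳ g)
  ⊠-comm (a ∷ f) g =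
    ≈-trans (⊞-cong ≈-refl (∷-cong (⊠-comm f g))) (≈-sym (⊠-∷ g a f))

  ⊠-cong : ∀ {f f′ g g′} → f ≈ f′ → g ≈ g′ → f ⊠ g ≈ f′ ⊠ g′
  ⊠-cong {f} {f′} {g} {g′} p q =
    ≈-trans (⊠-comm f g) (≈-trans (⊠-congʳ g p) (≈-trans (⊠-comm g f′) (⊠-congʳ f′ q)))

  ⊠-distribˡ : ∀ f g h → f ⊠ (g ⊞ h) ≈ f ⊠ g ⊞ f ⊠ h
  ⊠-distribˡ []      g h = ≈-refl
  ⊠-distribˡ (a ∷ f) g h .at k
    rewrite coef-⊞ (a ⊙ (g ⊞ h)) (0# ∷ f ⊠ (g ⊞ h)) k
          | coef-⊙ a (g ⊞ h) k
          | coef-⊞ g h k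
          | coef-⊞ (a ⊙ g ⊞ (0# ∷ f ⊠ g)) (a ⊙ h ⊞ (0# ∷ f ⊠ h)) k
          | coef-⊞ (a ⊙ g) (0# ∷ f ⊠ g) k
          | coef-⊞ (a ⊙ h) (0# ∷ f ⊠ h) k
          | coef-⊙ a g k
          | coef-⊙ a h k
          = trans (cong (a · (coef g k + coef h k) +_) (shifted k)) 
            (solve 5 (λ a x y z w → a :* (x :+ y) :+ (z :+ w) := a :* x :+ z :+ (a :* y :+ w))
              refl a _ _ _ _)
    where
    open 𝔽-Solver
    shifted : ∀ k → coef (0# ∷ f ⊠ (g ⊞ h)) k ≡ coef (0# ∷ f ⊠ g) k + coef (0# ∷ f ⊠ h) k
    shifted zero    = sym (+-identityˡ 0#)
    shifted (suc k) = trans (⊠-distribˡ f g h .at k) (coef-⊞ (f ⊠ g) (f ⊠ h) k)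

  ⊠-distribʳ : ∀ f g h → (g ⊞ h) ⊠ f ≈ g ⊠ f ⊞ h ⊠ f
  ⊠-distribʳ f g h =
    ≈-trans (⊠-comm (g ⊞ h) f) (≈-trans (⊠-distribˡ f g h) (⊞-cong (⊠-comm f g) (⊠-comm f h)))

  ⊙-⊠ : ∀ a f g → (a ⊙ f) ⊠ g ≈ a ⊙ (f ⊠ g)
  ⊙-⊠ a []      g = ≈-refl
  ⊙-⊠ a (b ∷ f) g .at k
    rewrite coef-⊞ ((a · b) ⊙ g) (0# ∷ (a ⊙ f) ⊠ g) k
          | coef-⊙ a (b ⊙ g ⊞ (0# ∷ f ⊠ g)) k
          | coef-⊞ (b ⊙ g) (0# ∷ f ⊠ g) k
          | coef-⊙ (a · b) g k
          | coef-⊙ b g k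
          = trans (cong (a · b · coef g k +_) (shifted k)) 
            (solve 4 (λ a b x y → a :* b :* x :+ a :* y := a :* (b :* x :+ y)) refl a b _ _)
    where
    open 𝔽-Solver
    shifted : ∀ k → coef (0# ∷ (a ⊙ f) ⊠ g) k ≡ a · coef (0# ∷ f ⊠ g) k
    shifted zero    = sym (zeroʳ a)
    shifted (suc k) = trans (⊙-⊠ a f g .at k) (coef-⊙ a (f ⊠ g) k)

  ∷-⊠ : ∀ f g → (0# ∷ f) ⊠ g ≈ 0# ∷ f ⊠ g
  ∷-⊠ f g .at k
    rewrite coef-⊞ (0# ⊙ g) (0# ∷ f ⊠ g) k | coef-⊙ 0# g k | zeroˡ (coef g k) = +-identityˡ _

  ⊠-assoc : ∀ f g h → (f ⊠ g) ⊠ h ≈ f ⊠ (g ⊠ h)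
  ⊠-assoc []      g h = ≈-refl
  ⊠-assoc (a ∷ f) g h =
    ≈-trans (⊠-distribʳ h (a ⊙ g) (0# ∷ f ⊠ g))
      (⊞-cong (⊙-⊠ a g h) (≈-trans (∷-⊠ (f ⊠ g) h) (∷-cong (⊠-assoc f g h))))

  const-⊠ : ∀ a f → (a ∷ []) ⊠ f ≈ a ⊙ f
  const-⊠ a f .at k rewrite coef-⊞ (a ⊙ f) (0# ∷ []) k =
    trans (cong (coef (a ⊙ f) k +_) (zeros k)) (+-identityʳ _)
    where
    zeros : ∀ k → coef (0# ∷ []) k ≡ 0#
    zeros zero    = refl
    zeros (suc k) = refl

  𝟙 : Poly F
  𝟙 = 1# ∷ []

  ⊠-identityˡ : ∀ f → 𝟙 ⊠ f ≈ f
  ⊠-identityˡ f = ≈-trans (const-⊠ 1# f) (coefs λ k → trans (coef-⊙ 1# f k) (*-identityˡ _))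

  𝔽[x] : CommutativeRing _ _
  𝔽[x] = record
    { Carrier = Poly F ; _≈_ = _≈_ ; _+_ = _⊞_ ; _*_ = _⊠_ ; -_ = ⊟_ ; 0# = [] ; 1# = 𝟙
    ; isCommutativeRing = record
      { isRing = record
        { +-isAbelianGroup = record
          { isGroup = record
            { isMonoid = record
              { isSemigroup = record
                { isMagma = record
                  { isEquivalence = record { refl = ≈-refl ; sym = ≈-sym ; trans = ≈-trans }
                  ; ∙-cong = ⊞-cong }
                ; assoc = ⊞-assoc }
              ; identity = (λ f → ≈-refl) , ⊞-identityʳ }
            ; inverse = (λ f → ≈-trans (⊞-comm (⊟ f) f) (⊟-inverseʳ f)) , ⊟-inverseʳ
            ; ⁻¹-cong = ⊙-cong }
          ; comm = ⊞-comm }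
        ; *-cong = ⊠-cong
        ; *-assoc = ⊠-assoc
        ; *-identity = ⊠-identityˡ , λ f → ≈-trans (⊠-comm f 𝟙) (⊠-identityˡ f)
        ; distrib = ⊠-distribˡ , ⊠-distribʳ }
      ; *-comm = ⊠-comm } }

  module 𝔽[x]-Solver = SemiringSolver (CommutativeRing.commutativeSemiring 𝔽[x])

  -- Monic polynomials and leading coefficients.

  data Monic : ℕ → Poly F → Set where
    one : Monic 0 𝟙
    _∷_ : ∀ a {d f} → Monic d f → Monic (suc d) (a ∷ f)

  Monic-coef : ∀ {d f} → Monic d f → coef f d ≡ 1#
  Monic-coef one     = refl
  Monic-coef (a ∷ m) = Monic-coef m

  Monic-coef> : ∀ {d f k} → Monic d f → d < k → coef f k ≡ 0#
  Monic-coef> one     (s≤s _)   = refl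
  Monic-coef> (a ∷ m) (s≤s d<k) = Monic-coef> m d<k

  Monic-length : ∀ {d f} → Monic d f → length f ≡ suc d
  Monic-length one     = refl
  Monic-length (a ∷ m) = cong suc (Monic-length m)

  Monic-degree : ∀ {d e f} → Monic d f → Monic e f → d ≡ e
  Monic-degree m n = ℕ.suc-injective (trans (sym (Monic-length m)) (Monic-length n))

  Monic-⊞ : ∀ {d f} g → length g ≤ d → Monic d f → Monic d (g ⊞ f)
  Monic-⊞ []      _         m       = m
  Monic-⊞ (b ∷ g) (s≤s g≤d) (a ∷ m) = (b + a) ∷ Monic-⊞ g g≤d m

  -- The length of `a ⊙ g` is at most the degree of the shifted product to which it is added, so the
  -- leading 1 comes from the latter. A constant left factor is separate: there the product itself
  -- is the scaled copy of `g`.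
  Monic-⊠ : ∀ {d e f g} → Monic d f → Monic e g → Monic (d ℕ.+ e) (f ⊠ g)
  Monic-⊠ one one = subst (λ a → Monic 0 (a ∷ [])) (sym (trans (+-identityʳ _) (*-identityˡ _))) one
  Monic-⊠ one (b ∷ n) =
    subst (Monic _) (cong (_ ∷_) (sym (one-⊙ n))) (_ ∷ n)
    where
    one-⊙ : ∀ {e g} → Monic e g → 1# ⊙ g ⊞ [] ≡ g
    one-⊙ one     = cong (_∷ []) (*-identityˡ _)
    one-⊙ (b ∷ one) = cong₂ _∷_ (*-identityˡ _) (cong (_∷ []) (*-identityˡ _))
    one-⊙ (b ∷ n@(_ ∷ _)) = cong₂ _∷_ (*-identityˡ _) (one-⊙ n)
  Monic-⊠ {e = e} {g = g} (a ∷ m) n =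
    Monic-⊞ (a ⊙ g)
      (ℕ.≤-trans (ℕ.≤-reflexive (trans (length-map _ g) (Monic-length n))) (s≤s (ℕ.m≤n+m e _)))
      (0# ∷ Monic-⊠ m n)

  tail-≈ : ∀ {a b f g} → a ∷ f ≈ b ∷ g → f ≈ g
  tail-≈ p .at k = p .at (suc k)

  1≢0 : 1# ≢ 0#
  1≢0 e = 0≢1 (sym e)

  Monic≉0 : ∀ {d f} → Monic d f → ¬ f ≈ []
  Monic≉0 m p = 1≢0 (trans (sym (Monic-coef m)) (p .at _))

  -- A monic list ends in 1, so it has no trailing zeros and is the canonical form of its
  -- polynomial. Equations obtained from the ring laws return through this lemma to `_≡_`, the
  -- relation by which `Φ` counts.
  Monic-≈⇒≡ : ∀ {d e f g} → Monic d f → Monic e g → f ≈ g → f ≡ g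
  Monic-≈⇒≡ one     one     p = refl
  Monic-≈⇒≡ one     (b ∷ n) p = ⊥-elim (Monic≉0 n (≈-sym (tail-≈ p)))
  Monic-≈⇒≡ (a ∷ m) one     p = ⊥-elim (Monic≉0 m (tail-≈ p))
  Monic-≈⇒≡ (a ∷ m) (b ∷ n) p = cong₂ _∷_ (p .at 0) (Monic-≈⇒≡ m n (tail-≈ p))

  -- Comparison of leading coefficients. If the degrees differed, 1 would equal 0: either `ρ` is a
  -- coefficient of `f` beyond its degree and vanishes, or the leading coefficient of `f` is `ρ`
  -- times a vanishing coefficient of `g`.
  Monic-⊙ : ∀ {d e f g} ρ → Monic d f → Monic e g → f ≈ ρ ⊙ g → ρ ≡ 1#
  Monic-⊙ {d} {e} {f} {g} ρ m n p with ℕ.<-cmp d e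
  ... | tri< d<e _ _ = ⊥-elim (1≢0 (begin
    1#             ≡⟨ Monic-coef m ⟨
    coef f d       ≡⟨ p .at d ⟩
    coef (ρ ⊙ g) d ≡⟨ coef-⊙ ρ g d ⟩
    ρ · coef g d   ≡⟨ cong (_· coef g d) ρ≡0 ⟩
    0# · coef g d  ≡⟨ zeroˡ _ ⟩
    0#             ∎))
    where
    open ≡-Reasoning
    ρ≡0 : ρ ≡ 0#
    ρ≡0 = begin
      ρ              ≡⟨ *-identityʳ ρ ⟨
      ρ · 1#         ≡⟨ cong (ρ ·_) (Monic-coef n) ⟨
      ρ · coef g e   ≡⟨ coef-⊙ ρ g e ⟨
      coef (ρ ⊙ g) e ≡⟨ p .at e ⟨
      coef f e       ≡⟨ Monic-coef> m d<e ⟩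
      0#             ∎
  ... | tri≈ _ refl _ = begin
    ρ              ≡⟨ *-identityʳ ρ ⟨
    ρ · 1#         ≡⟨ cong (ρ ·_) (Monic-coef n) ⟨
    ρ · coef g d   ≡⟨ coef-⊙ ρ g d ⟨
    coef (ρ ⊙ g) d ≡⟨ p .at d ⟨
    coef f d       ≡⟨ Monic-coef m ⟩
    1#             ∎
    where open ≡-Reasoning
  ... | tri> _ _ e<d = ⊥-elim (1≢0 (begin
    1#             ≡⟨ Monic-coef m ⟨
    coef f d       ≡⟨ p .at d ⟩
    coef (ρ ⊙ g) d ≡⟨ coef-⊙ ρ g d ⟩
    ρ · coef g d   ≡⟨ cong (ρ ·_) (Monic-coef> n e<d) ⟩
    ρ · 0#         ≡⟨ zeroʳ ρ ⟩
    0#             ∎))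
    where open ≡-Reasoning

  -- Zero, or a nonzero scalar times a monic polynomial. This takes the place of a degree function
  -- and supplies the leading coefficient by which Euclid's algorithm divides.
  data Normal (f : Poly F) : Set where
    vanishes : f ≈ [] → Normal f
    scaled   : ∀ ρ {d m} → ρ ≢ 0# → Monic d m → f ≈ ρ ⊙ m → Normal f

  normalise : ∀ f → Normal f
  normalise [] = vanishes ≈-refl
  normalise (a ∷ f) with normalise f
  ... | scaled ρ {m = m} ρ≢0 M p with inverse ρ ρ≢0
  ...   | σ , ρσ≡1 = scaled ρ {m = (σ · a) ∷ m} ρ≢0 (_ ∷ M) λ where
      .at zero    → sym (trans (sym (CommutativeRing.*-assoc 𝔽 ρ σ a))
                               (trans (cong (_· a) ρσ≡1) (*-identityˡ a)))
      .at (suc k) → p .at k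
  normalise (a ∷ f) | vanishes p with _≟F_ F a 0#
  ... | yes refl = vanishes λ where
      .at zero    → refl
      .at (suc k) → p .at k
  ... | no a≢0 = scaled a a≢0 one λ where
      .at zero    → sym (*-identityʳ a)
      .at (suc k) → p .at k

  ⊙-coef : ∀ {d m f} ρ → Monic d m → f ≈ ρ ⊙ m → coef f d ≡ ρ
  ⊙-coef {d} {m} ρ M p =
    trans (p .at d) (trans (coef-⊙ ρ m d) (trans (cong (ρ ·_) (Monic-coef M)) (*-identityʳ ρ)))

-- Cancellation, and refinement of u v = w z by Euclid's algorithm.

module Refinements (F : FiniteField) where
  open FiniteField F using (Carrier; 0#; 1#; _·_; inverse) renaming (_+_ to _+ᶠ_)
  open Polynomials F
  open _≈_
  open CommutativeRing 𝔽[x] using (setoid; -‿inverseˡ) renaming (ring to 𝔽[x]-ring; _-_ to _-ₚ_)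
  open RingProperties 𝔽[x]-ring using (x[y-z]≈xy-xz; [y-z]x≈yx-zx)
  module ≈-Reasoning = SetoidReasoning setoid

  ⊠-congˡ : ∀ h {f g} → f ≈ g → f ⊠ h ≈ g ⊠ h
  ⊠-congˡ h p = ⊠-cong p ≈-refl

  ⊞-congˡ : ∀ h {f g} → f ≈ g → f ⊞ h ≈ g ⊞ h
  ⊞-congˡ h p = ⊞-cong p ≈-refl

  ⊟-cancel : ∀ f g → (f -ₚ g) ⊞ g ≈ f
  ⊟-cancel f g = ≈-trans (⊞-assoc f (⊟ g) g) (≈-trans (⊞-cong ≈-refl (-‿inverseˡ g)) (⊞-identityʳ f))

  ⊠-⊙ : ∀ ρ f g → f ⊠ (ρ ⊙ g) ≈ ρ ⊙ (f ⊠ g)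
  ⊠-⊙ ρ f g = ≈-trans (⊠-comm f _) (≈-trans (⊙-⊠ ρ g f) (⊙-cong (⊠-comm g f)))

  -- If `f -ₚ g` were `ρ` times a monic polynomial with `ρ` nonzero, its product with `w` would have
  -- the leading coefficient `ρ`, yet that product vanishes.
  ⊠-cancelˡ : ∀ {d w f g} → Monic d w → w ⊠ f ≈ w ⊠ g → f ≈ g
  ⊠-cancelˡ {d} {w} {f} {g} W p with normalise (f -ₚ g)
  ... | vanishes q = ≈-trans (≈-sym (⊟-cancel f g)) (⊞-cong q ≈-refl)
  ... | scaled ρ {e} {m} ρ≢0 M q = ⊥-elim (ρ≢0 (begin
    ρ                           ≡⟨ ⊙-coef ρ (Monic-⊠ W M) (≈-trans (⊠-congʳ w q) (⊠-⊙ ρ w m)) ⟨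
    coef (w ⊠ (f -ₚ g)) (d ℕ.+ e) ≡⟨ x[y-z]≈xy-xz w f g .at _ ⟩
    coef (w ⊠ f -ₚ w ⊠ g) (d ℕ.+ e) ≡⟨ ⊞-cong p ≈-refl .at _ ⟩
    coef (w ⊠ g -ₚ w ⊠ g) (d ℕ.+ e) ≡⟨ ⊟-inverseʳ (w ⊠ g) .at _ ⟩
    0#                          ∎))
    where open ≡-Reasoning

  -- When `h` is `ρ` times a monic `m`, `v` is `ρ` times the monic `b ⊠ m`, which forces `ρ` to be
  -- 1.
  Monic-quotient : ∀ {d e b v h} → Monic d b → Monic e v → v ≈ b ⊠ h → ∃[ k ] ∃[ m ] Monic k m × h ≈ m
  Monic-quotient {b = b} {v} {h} B V p with normalise h
  ... | vanishes q = ⊥-elim (Monic≉0 V (≈-trans p (≈-trans (⊠-congʳ b q) (⊠-zeroʳ b))))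
  ... | scaled ρ {k} {m} ρ≢0 M q =
    k , m , M , ≈-trans q (coefs λ i → trans (coef-⊙ ρ m i)
      (trans (cong (_· coef m i) ρ≡1) (CommutativeRing.*-identityˡ 𝔽 _)))
    where
    ρ≡1 : ρ ≡ 1#
    ρ≡1 = Monic-⊙ ρ V (Monic-⊠ B M) (≈-trans p (≈-trans (⊠-congʳ b q) (⊠-⊙ ρ b m)))

  x^_ : ℕ → Poly F
  x^ zero  = 𝟙
  x^ suc k = 0# ∷ x^ k

  Monic-x^ : ∀ k → Monic k (x^ k)
  Monic-x^ zero    = one
  Monic-x^ (suc k) = 0# ∷ Monic-x^ k

  -- The Euclidean step divides by leading coefficients, so v, z and h are not kept monic here.
  record GeneralRefinement (u v w z : Poly F) : Set where
    field
      {i j k} : ℕ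
      {g a b h} : Poly F
      monic-g : Monic i g
      monic-a : Monic j a
      monic-b : Monic k b
      u≡ga : u ≡ g ⊠ a
      w≡gb : w ≡ g ⊠ b
      v≈bh : v ≈ b ⊠ h
      z≈ah : z ≈ a ⊠ h

  -- The induction measure is the sum of the two degrees. `v` and `z` stay universally quantified
  -- because the recursive call replaces them.
  Refinable : ℕ → Set
  Refinable N = ∀ {d e u w} → Monic d u → Monic e w → d ℕ.+ e < N →
                ∀ v z → u ⊠ v ≈ w ⊠ z → GeneralRefinement u v w z

  -- With c = x^(d-e), the difference u - c w is zero or ρ m with m monic of degree below d. In the
  -- second case w z′ = m v for z′ = ρ⁻¹ (z - c v). A refinement w = g a, m = g b, z′ = b h, v = a h
  -- of this equation gives u = g (ρ b + c a) and z = (ρ b + c a) h.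
  refine-step : ∀ {N} → Refinable N → ∀ {d e u w} → Monic d u → Monic e w → e ≤ d → d ℕ.+ e < suc N →
                ∀ v z → u ⊠ v ≈ w ⊠ z → GeneralRefinement u v w z
  refine-step {N} rec {d} {e} {u} {w} U W e≤d d+e≤N v z p = go (normalise (u -ₚ c ⊠ w))
    where
    k = d ∸ e
    c = x^ k
    CW : Monic d (c ⊠ w)
    CW = subst (λ n → Monic n (c ⊠ w)) (ℕ.m∸n+n≡m e≤d) (Monic-⊠ (Monic-x^ k) W)

    open 𝔽[x]-Solver using (solve; _:+_; _:*_; _:=_)

    go : Normal (u -ₚ c ⊠ w) → GeneralRefinement u v w z
    -- Here `w` divides `u`, and the refinement is g = w, a = c, b = 1, h = v.
    go (vanishes q) = record
      { monic-g = W ; monic-a = Monic-x^ k ; monic-b = one ; h = v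
      ; u≡ga = Monic-≈⇒≡ U (Monic-⊠ W (Monic-x^ k)) (≈-trans u≈cw (⊠-comm c w))
      ; w≡gb = Monic-≈⇒≡ W (Monic-⊠ W one) (≈-sym (CommutativeRing.*-identityʳ 𝔽[x] w))
      ; v≈bh = ≈-sym (⊠-identityˡ v)
      ; z≈ah = ⊠-cancelˡ W (≈-trans (≈-sym p) (≈-trans (⊠-congˡ v u≈cw)
                 (solve 3 (λ c w v → c :* w :* v := w :* (c :* v)) ≈-refl c w v)))
      }
      where
      u≈cw : u ≈ c ⊠ w
      u≈cw = ≈-trans (≈-sym (⊟-cancel u (c ⊠ w))) (⊞-cong q ≈-refl)
    go (scaled ρ {d′} {m} ρ≢0 M q) = lift (rec W M e+d′<N z′ v wz′≈mv)
      where
      σ = proj₁ (inverse ρ ρ≢0)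
      ρσ≡1 = proj₂ (inverse ρ ρ≢0)
      [ρ] [σ] z′ : Poly F
      [ρ] = ρ ∷ []
      [σ] = σ ∷ []
      z′ = [σ] ⊠ (z -ₚ c ⊠ v)

      [ρ][σ]≈𝟙 : [ρ] ⊠ [σ] ≈ 𝟙
      [ρ][σ]≈𝟙 = ≡⇒≈ (cong (_∷ []) (trans (CommutativeRing.+-identityʳ 𝔽 _) ρσ≡1))

      q′ : u -ₚ c ⊠ w ≈ [ρ] ⊠ m
      q′ = ≈-trans q (≈-sym (const-⊠ ρ m))

      -- The leading terms of `u` and `c ⊠ w` cancel, so the coefficients of the difference vanish
      -- from index `d` on, whereas the one at `d′` is `ρ`.
      d′<d : d′ < d
      d′<d with d′ ℕ.<? d
      ... | yes lt = lt
      ... | no d′≮d = ⊥-elim (ρ≢0 (trans (sym (⊙-coef ρ M q)) (top (ℕ.m≤n⇒m<n∨m≡n (ℕ.≮⇒≥ d′≮d)))))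
        where
        same : d < d′ ⊎ d ≡ d′ → coef u d′ ≡ coef (c ⊠ w) d′
        same (inj₁ d<d′) = trans (Monic-coef> U d<d′) (sym (Monic-coef> CW d<d′))
        same (inj₂ refl) = trans (Monic-coef U) (sym (Monic-coef CW))
        top : d < d′ ⊎ d ≡ d′ → coef (u -ₚ c ⊠ w) d′ ≡ 0#
        top d≤d′ = begin
          coef (u -ₚ c ⊠ w) d′                        ≡⟨ coef-⊞ u _ d′ ⟩
          coef u d′ +ᶠ coef (⊟ (c ⊠ w)) d′            ≡⟨ cong (_+ᶠ _) (same d≤d′) ⟩
          coef (c ⊠ w) d′ +ᶠ coef (⊟ (c ⊠ w)) d′      ≡⟨ coef-⊞ (c ⊠ w) _ d′ ⟨
          coef (c ⊠ w -ₚ c ⊠ w) d′                    ≡⟨ ⊟-inverseʳ (c ⊠ w) .at d′ ⟩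
          0#                                          ∎
          where open ≡-Reasoning

      wz′≈mv : w ⊠ z′ ≈ m ⊠ v
      wz′≈mv = begin
        w ⊠ z′
          ≈⟨ solve 3 (λ w s y → w :* (s :* y) := s :* (w :* y)) ≈-refl w [σ] (z -ₚ c ⊠ v) ⟩
        [σ] ⊠ (w ⊠ (z -ₚ c ⊠ v))        ≈⟨ ⊠-congʳ [σ] (x[y-z]≈xy-xz w z (c ⊠ v)) ⟩
        [σ] ⊠ (w ⊠ z -ₚ w ⊠ (c ⊠ v))
          ≈⟨ ⊠-congʳ [σ] (⊞-cong (≈-sym p) (⊙-cong {f = w ⊠ (c ⊠ v)} {c ⊠ w ⊠ v} (solve 3 (λ c w v → w :* (c :* v) := c :* w :* v) ≈-refl c w v))) ⟩
        [σ] ⊠ (u ⊠ v -ₚ c ⊠ w ⊠ v)      ≈⟨ ⊠-congʳ [σ] ([y-z]x≈yx-zx v u (c ⊠ w)) ⟨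
        [σ] ⊠ ((u -ₚ c ⊠ w) ⊠ v)        ≈⟨ ⊠-congʳ [σ] (⊠-congˡ v q′) ⟩
        [σ] ⊠ ([ρ] ⊠ m ⊠ v)
          ≈⟨ solve 4 (λ s r m v → s :* (r :* m :* v) := (r :* s) :* (m :* v)) ≈-refl [σ] [ρ] m v ⟩
        ([ρ] ⊠ [σ]) ⊠ (m ⊠ v)           ≈⟨ ⊠-congˡ (m ⊠ v) [ρ][σ]≈𝟙 ⟩
        𝟙 ⊠ (m ⊠ v)                     ≈⟨ ⊠-identityˡ _ ⟩
        m ⊠ v                           ∎
        where open ≈-Reasoning

      e+d′<N : e ℕ.+ d′ < N
      e+d′<N = ℕ.<-≤-trans (subst (e ℕ.+ d′ <_) (ℕ.+-comm e d) (ℕ.+-monoʳ-< e d′<d)) (ℕ.s≤s⁻¹ d+e≤N)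

      lift : GeneralRefinement w z′ m v → GeneralRefinement u v w z
      lift record { i = i ; j = j ; k = l ; g = g ; a = a ; b = b ; h = h
                  ; monic-g = G ; monic-a = A ; monic-b = B ; u≡ga = w≡ga ; w≡gb = m≡gb
                  ; v≈bh = z′≈bh ; z≈ah = v≈ah } = record
        { monic-g = G ; monic-a = A′ ; monic-b = A ; h = h
        ; u≡ga = Monic-≈⇒≡ U (Monic-⊠ G A′) (let open ≈-Reasoning in begin
            u                                   ≈⟨ ⊟-cancel u _ ⟨
            (u -ₚ c ⊠ w) ⊞ c ⊠ w                ≈⟨ ⊞-cong q′ (⊠-congʳ c (≡⇒≈ w≡ga)) ⟩
            [ρ] ⊠ m ⊞ c ⊠ (g ⊠ a)               ≈⟨ ⊞-congˡ (c ⊠ (g ⊠ a)) (⊠-congʳ [ρ] (≡⇒≈ m≡gb)) ⟩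
            [ρ] ⊠ (g ⊠ b) ⊞ c ⊠ (g ⊠ a)
              ≈⟨ solve 5 (λ r g b c a → r :* (g :* b) :+ c :* (g :* a) := g :* (r :* b :+ c :* a)) ≈-refl [ρ] g b c a ⟩
            g ⊠ ([ρ] ⊠ b ⊞ c ⊠ a)               ≈⟨ ⊠-congʳ g a′≈ ⟨
            g ⊠ a′                              ∎)
        ; w≡gb = w≡ga
        ; v≈bh = v≈ah
        ; z≈ah = let open ≈-Reasoning in begin
            z                             ≈⟨ ⊟-cancel z (c ⊠ v) ⟨
            (z -ₚ c ⊠ v) ⊞ c ⊠ v          ≈⟨ ⊞-congˡ (c ⊠ v) (⊠-identityˡ (z -ₚ c ⊠ v)) ⟨
            𝟙 ⊠ (z -ₚ c ⊠ v) ⊞ c ⊠ v      ≈⟨ ⊞-congˡ (c ⊠ v) (⊠-congˡ (z -ₚ c ⊠ v) [ρ][σ]≈𝟙) ⟨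
            ([ρ] ⊠ [σ]) ⊠ (z -ₚ c ⊠ v) ⊞ c ⊠ v
              ≈⟨ ⊞-cong (⊠-assoc [ρ] [σ] (z -ₚ c ⊠ v)) (⊠-congʳ c v≈ah) ⟩
            [ρ] ⊠ z′ ⊞ c ⊠ (a ⊠ h)        ≈⟨ ⊞-congˡ (c ⊠ (a ⊠ h)) (⊠-congʳ [ρ] z′≈bh) ⟩
            [ρ] ⊠ (b ⊠ h) ⊞ c ⊠ (a ⊠ h)
              ≈⟨ solve 5 (λ r h b c a → r :* (b :* h) :+ c :* (a :* h) := (r :* b :+ c :* a) :* h) ≈-refl [ρ] h b c a ⟩
            ([ρ] ⊠ b ⊞ c ⊠ a) ⊠ h         ≈⟨ ⊠-congˡ h a′≈ ⟨
            a′ ⊠ h                        ∎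
        }
        where
        a′ : Poly F
        a′ = ρ ⊙ b ⊞ c ⊠ a

        a′≈ : a′ ≈ [ρ] ⊠ b ⊞ c ⊠ a
        a′≈ = ⊞-cong (≈-sym (const-⊠ ρ b)) ≈-refl

        -- `b` has the degree d′ - i and `c ⊠ a` the degree d - i; since d′ < d, adding `ρ ⊙ b`
        -- leaves `c ⊠ a` monic.
        l<k+j : l < k ℕ.+ j
        l<k+j = ℕ.+-cancelˡ-< i l (k ℕ.+ j) (begin-strict
          i ℕ.+ l         ≡⟨ Monic-degree (Monic-⊠ G B) (subst (Monic d′) m≡gb M) ⟩
          d′              <⟨ d′<d ⟩
          d               ≡⟨ ℕ.m∸n+n≡m e≤d ⟨
          k ℕ.+ e
            ≡⟨ cong (k ℕ.+_) (Monic-degree W (subst (Monic (i ℕ.+ j)) (sym w≡ga) (Monic-⊠ G A))) ⟩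
          k ℕ.+ (i ℕ.+ j) ≡⟨ +-swap k i j ⟩
          i ℕ.+ (k ℕ.+ j) ∎)
          where
          open ℕ.≤-Reasoning
          +-swap : ∀ x y z → x ℕ.+ (y ℕ.+ z) ≡ y ℕ.+ (x ℕ.+ z)
          +-swap = ℕ-solve-∀

        A′ : Monic (k ℕ.+ j) a′
        A′ = Monic-⊞ (ρ ⊙ b) (ℕ.≤-trans (ℕ.≤-reflexive (trans (length-map _ b) (Monic-length B))) l<k+j) (Monic-⊠ (Monic-x^ k) A)

  swap : ∀ {u v w z} → GeneralRefinement u v w z → GeneralRefinement w z u v
  swap r = record
    { monic-g = monic-g ; monic-a = monic-b ; monic-b = monic-a
    ; u≡ga = w≡gb ; w≡gb = u≡ga ; v≈bh = z≈ah ; z≈ah = v≈bh }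
    where open GeneralRefinement r

  refinable : ∀ N → Refinable N
  refinable (suc N) {d} {e} U W lt v z p with ℕ.≤-total e d
  ... | inj₁ e≤d = refine-step (refinable N) U W e≤d lt v z p
  ... | inj₂ d≤e = swap (refine-step (refinable N) W U d≤e
                          (subst (_< suc N) (ℕ.+-comm d e) lt) z v (≈-sym p))

  record Refinement (u v w z : Poly F) : Set where
    field
      {i j k l} : ℕ
      {g a b h} : Poly F
      monic-g : Monic i g
      monic-a : Monic j a
      monic-b : Monic k b
      monic-h : Monic l h
      u≡ga : u ≡ g ⊠ a
      v≡bh : v ≡ b ⊠ h
      w≡gb : w ≡ g ⊠ b
      z≡ah : z ≡ a ⊠ h

  -- Only `h` is not yet known to be monic; it is the cofactor of the monic `b` in the monic `v`.
  -- Then all four equations relate monic lists, so they hold as `_≡_`.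
  refine : ∀ {d₁ d₂ d₃ d₄ u v w z} → Monic d₁ u → Monic d₂ v → Monic d₃ w → Monic d₄ z →
           u ⊠ v ≡ w ⊠ z → Refinement u v w z
  refine {v = v} {z = z} U V W Z p with refinable _ U W ℕ.≤-refl v z (≡⇒≈ p)
  ... | record { g = g ; a = a ; b = b ; monic-g = G ; monic-a = A ; monic-b = B
               ; u≡ga = u≡ga ; w≡gb = w≡gb ; v≈bh = v≈bh ; z≈ah = z≈ah }
    with l , m , M , h≈m ← Monic-quotient B V v≈bh = record
    { monic-g = G ; monic-a = A ; monic-b = B ; monic-h = M ; u≡ga = u≡ga ; w≡gb = w≡gb
    ; v≡bh = Monic-≈⇒≡ V (Monic-⊠ B M) (≈-trans v≈bh (⊠-congʳ b h≈m))
    ; z≡ah = Monic-≈⇒≡ Z (Monic-⊠ A M) (≈-trans z≈ah (⊠-congʳ a h≈m)) }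

-- Counting with lists.

module Lists where
  open import Data.Nat using (_+_; _*_)

  private variable
    A B C : Set

  -- Pigeonhole for a relation in place of a function: the partner of `x` may come from an existence
  -- proof, and one lemma serves both covering (`x` is the image of `y`) and embedding (`y` is the
  -- image of `x`). Repetitions in `ys` are allowed.
  length-≤ : {R : A → B → Set} (xs : List A) (ys : List B) → Unique xs →
             (∀ {x} → x ∈ xs → ∃[ y ] y ∈ ys × R x y) →
             (∀ {x x′ y} → x ∈ xs → x′ ∈ xs → R x y → R x′ y → x ≡ x′) →
             length xs ≤ length ys
  length-≤ [] ys _ _ _ = z≤n
  length-≤ {R = R} (x ∷ xs) ys (x∉xs ∷ u) total inj
    with y , y∈ys , Rxy ← total (here refl)
    with pre , post , refl ← ∈-∃++ y∈ys = begin
      suc (length xs)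
        ≤⟨ s≤s (length-≤ xs (pre ++ post) u total′ λ p q → inj (there p) (there q)) ⟩
      suc (length (pre ++ post))        ≡⟨ cong suc (length-++ pre) ⟩
      suc (length pre + length post)    ≡⟨ ℕ.+-suc (length pre) (length post) ⟨
      length pre + suc (length post)    ≡⟨ length-++ pre ⟨
      length (pre ++ y ∷ post)          ∎
    where
    open ℕ.≤-Reasoning
    total′ : ∀ {x′} → x′ ∈ xs → ∃[ y′ ] y′ ∈ pre ++ post × R x′ y′
    total′ x′∈xs with y′ , y′∈ys , Rx′y′ ← total (there x′∈xs) with ∈-++⁻ pre y′∈ys
    ... | inj₁ y′∈pre           = y′ , ∈-++⁺ˡ y′∈pre , Rx′y′
    ... | inj₂ (there y′∈post)  = y′ , ∈-++⁺ʳ pre y′∈post , Rx′y′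
    -- The partner of `x` has been deleted from `ys`; a later `x′` with the same partner would equal
    -- `x`, against uniqueness.
    ... | inj₂ (here refl)      =
      ⊥-elim (All.lookup x∉xs x′∈xs (inj (here refl) (there x′∈xs) Rxy Rx′y′))

  ∈-concatMap : ∀ {f : A → List B} {xs x y} → x ∈ xs → y ∈ f x → y ∈ concatMap f xs
  ∈-concatMap {f = f} x∈xs y∈fx = ∈-concatMap⁺ f (lose x∈xs y∈fx)

  concatMap-∈ : ∀ {f : A → List B} {xs y} → y ∈ concatMap f xs → ∃[ x ] x ∈ xs × y ∈ f x
  concatMap-∈ {f = f} {xs} y∈ = find (∈-concatMap⁻ f {xs = xs} y∈)

  Unique-concatMap : ∀ {f : A → List B} {xs} → Unique xs → (∀ x → Unique (f x)) →
                     (∀ {x x′ y} → y ∈ f x → y ∈ f x′ → x ≡ x′) → Unique (concatMap f xs)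
  Unique-concatMap {f = f} {[]} [] uf det = []
  Unique-concatMap {f = f} {x ∷ xs} (x∉xs ∷ u) uf det =
    Unique.++⁺ (uf x) (Unique-concatMap u uf det) λ where
      (y∈fx , y∈rest) → let x′ , x′∈xs , y∈fx′ = concatMap-∈ {f = f} {xs} y∈rest in
                        All.lookup x∉xs x′∈xs (det y∈fx y∈fx′)

  sum-map-≤ : ∀ {f g : A → ℕ} xs → (∀ {x} → x ∈ xs → f x ≤ g x) → sum (map f xs) ≤ sum (map g xs)
  sum-map-≤ []       p = z≤n
  sum-map-≤ (x ∷ xs) p = ℕ.+-mono-≤ (p (here refl)) (sum-map-≤ xs (p ∘ there))

  sum-map-* : ∀ K (f : A → ℕ) xs → sum (map (λ x → K * f x) xs) ≡ K * sum (map f xs)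
  sum-map-* K f []       = sym (ℕ.*-zeroʳ K)
  sum-map-* K f (x ∷ xs) =
    trans (cong (K * f x +_) (sum-map-* K f xs)) (sym (ℕ.*-distribˡ-+ K (f x) _))

  sum-map-const : ∀ K (xs : List A) → sum (map (λ _ → K) xs) ≡ length xs * K
  sum-map-const K []       = refl
  sum-map-const K (x ∷ xs) = cong (K +_) (sum-map-const K xs)

  sum-map-+ : ∀ (f g : A → ℕ) xs → sum (map (λ x → f x + g x) xs) ≡ sum (map f xs) + sum (map g xs)
  sum-map-+ f g []       = refl
  sum-map-+ f g (x ∷ xs) =
    trans (cong (f x + g x +_) (sum-map-+ f g xs)) (interchange (f x) (g x) _ _)
    where open import Algebra.Properties.CommutativeSemigroup ℕ.+-commutativeSemigroup using (interchange)

  length-concatMap : ∀ (f : A → List B) xs → length (concatMap f xs) ≡ sum (map (length ∘ f) xs)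
  length-concatMap f []       = refl
  length-concatMap f (x ∷ xs) = trans (length-++ (f x)) (cong (length (f x) +_) (length-concatMap f xs))

  length-concatMap-≤ : ∀ {f : A → List B} {w : A → ℕ} {K} xs →
                       (∀ {x} → x ∈ xs → length (f x) ≤ K * w x) →
                       length (concatMap f xs) ≤ K * sum (map w xs)
  length-concatMap-≤ {f = f} {w} {K} xs p = begin
    length (concatMap f xs)       ≡⟨ length-concatMap f xs ⟩
    sum (map (length ∘ f) xs)     ≤⟨ sum-map-≤ xs p ⟩
    sum (map (λ x → K * w x) xs)  ≡⟨ sum-map-* K w xs ⟩
    K * sum (map w xs)            ∎
    where open ℕ.≤-Reasoning

  length-× : ∀ (xs : List A) (ys : List B) → length (cartesianProduct xs ys) ≡ length xs * length ys
  length-× []       ys = refl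
  length-× (x ∷ xs) ys = trans (length-++ (map (x ,_) ys)) (cong₂ _+_ (length-map (x ,_) ys) (length-× xs ys))

  upTo-∷ʳ : ∀ n → upTo (suc n) ≡ upTo n ∷ʳ n
  upTo-∷ʳ n = sym (List.applyUpTo-∷ʳ (λ x → x) n)

  sum-upTo-suc : ∀ (f : ℕ → ℕ) n → sum (map f (upTo (suc n))) ≡ sum (map f (upTo n)) + f n
  sum-upTo-suc f n = begin
    sum (map f (upTo (suc n)))             ≡⟨ cong (sum ∘ map f) (upTo-∷ʳ n) ⟩
    sum (map f (upTo n ∷ʳ n))              ≡⟨ cong sum (List.map-++ f (upTo n) (n ∷ [])) ⟩
    sum (map f (upTo n) ++ f n ∷ [])       ≡⟨ sum-++ (map f (upTo n)) (f n ∷ []) ⟩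
    sum (map f (upTo n)) + (f n + 0)       ≡⟨ cong (sum (map f (upTo n)) +_) (ℕ.+-identityʳ (f n)) ⟩
    sum (map f (upTo n)) + f n             ∎
    where open ≡-Reasoning

  sigma : List A → (A → List B) → List (A × B)
  sigma xs f = concatMap (λ x → map (x ,_) (f x)) xs

  ∈-sigma : ∀ {xs : List A} {f : A → List B} {x y} → x ∈ xs → y ∈ f x → (x , y) ∈ sigma xs f
  ∈-sigma x∈xs y∈fx = ∈-concatMap x∈xs (∈-map⁺ _ y∈fx)

  sigma-∈ : ∀ {xs : List A} {f : A → List B} {x y} → (x , y) ∈ sigma xs f → x ∈ xs × y ∈ f x
  sigma-∈ {xs = xs} {f} p with x , x∈xs , q ← concatMap-∈ {xs = xs} p
    with y , y∈fx , refl ← ∈-map⁻ (x ,_) q = x∈xs , y∈fx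

  Unique-sigma : ∀ {xs : List A} {f : A → List B} → Unique xs → (∀ x → Unique (f x)) → Unique (sigma xs f)
  Unique-sigma {f = f} u uf = Unique-concatMap u (λ x → Unique.map⁺ (λ { refl → refl }) (uf x)) det
    where
    det : ∀ {x x′ y} → y ∈ map (x ,_) (f x) → y ∈ map (x′ ,_) (f x′) → x ≡ x′
    det p q with _ , _ , refl ← ∈-map⁻ _ p with _ , _ , refl ← ∈-map⁻ _ q = refl

  length-sigma : ∀ (xs : List A) (f : A → List B) → length (sigma xs f) ≡ sum (map (length ∘ f) xs)
  length-sigma xs f = trans (length-concatMap _ xs)
    (cong sum (List.map-cong (λ x → length-map (x ,_) (f x)) xs))

-- Enumerations of monic polynomials, and the moments as numbers of solutions.

module MonicLists (F : FiniteField) where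
  open FiniteField F using (Carrier; 0#; 1#; 0≢1; q; enum)
  open Inverse enum using (to; from; strictlyInverseˡ; strictlyInverseʳ)
  open Polynomials F
  open Lists
  open import Data.Nat using (_+_; _*_)

  1<q : 1 < q
  1<q = distinct q (from 0#) (from 1#)
    (λ e → 0≢1 (trans (sym (strictlyInverseˡ 0#)) (trans (cong to e) (strictlyInverseˡ 1#))))
    where
    distinct : ∀ n → (i j : Fin n) → i ≢ j → 1 < n
    distinct 1             zero zero i≢j = ⊥-elim (i≢j refl)
    distinct (suc (suc n)) _    _    _   = s≤s (s≤s z≤n)

  ∈-elems : ∀ a → a ∈ elems F
  ∈-elems a = subst (_∈ elems F) (strictlyInverseˡ a) (∈-map⁺ to (∈-allFin (from a)))

  Unique-elems : Unique (elems F)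
  Unique-elems = Unique.map⁺
    (λ {x} {y} e → trans (sym (strictlyInverseʳ x)) (trans (cong from e) (strictlyInverseʳ y)))
    (Unique.allFin⁺ q)

  length-elems : length (elems F) ≡ q
  length-elems = trans (length-map to (allFin q)) (List.length-tabulate {n = q} (λ i → i))

  Unique-allVecs : ∀ d → Unique (allVecs F d)
  Unique-allVecs zero    = All.[] ∷ []
  Unique-allVecs (suc d) = Unique-concatMap Unique-elems
    (λ x → Unique.map⁺ (λ { refl → refl }) (Unique-allVecs d)) det
    where
    det : ∀ {x x′ y} → y ∈ map (x ∷_) (allVecs F d) → y ∈ map (x′ ∷_) (allVecs F d) → x ≡ x′
    det p p′ with _ , _ , refl ← ∈-map⁻ _ p with _ , _ , refl ← ∈-map⁻ _ p′ = refl

  length-allVecs : ∀ d → length (allVecs F d) ≡ q ^ d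
  length-allVecs zero    = refl
  length-allVecs (suc d) = begin
    length (allVecs F (suc d))                           ≡⟨ length-concatMap _ (elems F) ⟩
    sum (map (λ x → length (map (x ∷_) (allVecs F d))) (elems F))
      ≡⟨ cong sum (List.map-cong (λ x → trans (length-map (x ∷_) (allVecs F d)) (length-allVecs d)) (elems F)) ⟩
    sum (map (λ _ → q ^ d) (elems F))                    ≡⟨ sum-map-const (q ^ d) (elems F) ⟩
    length (elems F) * q ^ d                             ≡⟨ cong (_* q ^ d) length-elems ⟩
    q * q ^ d                                            ∎
    where open ≡-Reasoning

  monicsOfDegree : ℕ → List (Poly F)
  monicsOfDegree d = map (λ v → v ++ (1# ∷ [])) (allVecs F d)

  monicsBelow : ℕ → List (Poly F)
  monicsBelow m = concatMap monicsOfDegree (upTo m)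

  ∈-monicsOfDegree : ∀ {d f} → Monic d f → f ∈ monicsOfDegree d
  ∈-monicsOfDegree one     = here refl
  ∈-monicsOfDegree (a ∷ m) with v , v∈ , refl ← ∈-map⁻ _ (∈-monicsOfDegree m) =
    ∈-map⁺ _ (∈-concatMap (∈-elems a) (∈-map⁺ (a ∷_) v∈))

  monicsOfDegree-∈ : ∀ {d f} → f ∈ monicsOfDegree d → Monic d f
  monicsOfDegree-∈ {d} f∈ with v , v∈ , refl ← ∈-map⁻ _ f∈ = go d v∈
    where
    go : ∀ d {v} → v ∈ allVecs F d → Monic d (v ++ (1# ∷ []))
    go zero    (here refl) = one
    go (suc d) v∈ with a , _ , v∈′ ← concatMap-∈ {xs = elems F} v∈
      with w , w∈ , refl ← ∈-map⁻ (a ∷_) v∈′ = a ∷ go d w∈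

  ∈-monicsBelow : ∀ {d m f} → Monic d f → d < m → f ∈ monicsBelow m
  ∈-monicsBelow M d<m = ∈-concatMap (∈-upTo⁺ d<m) (∈-monicsOfDegree M)

  monicsBelow-∈ : ∀ {m f} → f ∈ monicsBelow m → ∃[ d ] d < m × Monic d f
  monicsBelow-∈ {m} f∈ with d , d∈ , f∈′ ← concatMap-∈ {xs = upTo m} f∈ =
    d , ∈-upTo⁻ d∈ , monicsOfDegree-∈ f∈′

  Unique-monicsOfDegree : ∀ d → Unique (monicsOfDegree d)
  Unique-monicsOfDegree d = Unique.map⁺ (List.++-cancelʳ _ _ _) (Unique-allVecs d)

  Unique-monicsBelow : ∀ m → Unique (monicsBelow m)
  Unique-monicsBelow m = Unique-concatMap (Unique.upTo⁺ m) Unique-monicsOfDegree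
    λ p p′ → Monic-degree (monicsOfDegree-∈ p) (monicsOfDegree-∈ p′)

  length-monicsOfDegree : ∀ d → length (monicsOfDegree d) ≡ q ^ d
  length-monicsOfDegree d = trans (length-map _ (allVecs F d)) (length-allVecs d)

  ∣B∣ : ℕ → ℕ
  ∣B∣ m = length (monicsBelow m)

  ∣B∣-suc : ∀ m → ∣B∣ (suc m) ≡ ∣B∣ m + q ^ m
  ∣B∣-suc m = begin
    ∣B∣ (suc m)
      ≡⟨ length-concatMap monicsOfDegree (upTo (suc m)) ⟩
    sum (map (length ∘ monicsOfDegree) (upTo (suc m))) ≡⟨ sum-upTo-suc (length ∘ monicsOfDegree) m ⟩
    sum (map (length ∘ monicsOfDegree) (upTo m)) + length (monicsOfDegree m)
      ≡⟨ cong₂ _+_ (sym (length-concatMap monicsOfDegree (upTo m))) (length-monicsOfDegree m) ⟩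
    ∣B∣ m + q ^ m                                      ∎
    where open ≡-Reasoning

  -- The denominator of the geometric series that counts monic polynomials; estimates are scaled by
  -- it and it is cancelled at the end.
  p : ℕ
  p = q ∸ 1

  q≡suc-p : q ≡ suc p
  q≡suc-p = sym (ℕ.m+[n∸m]≡n (ℕ.<⇒≤ 1<q))

  geometric : ∀ m → p * ∣B∣ m + 1 ≡ q ^ m
  geometric zero    = cong (_+ 1) (ℕ.*-zeroʳ p)
  geometric (suc m) = begin
    p * ∣B∣ (suc m) + 1           ≡⟨ cong (λ b → p * b + 1) (∣B∣-suc m) ⟩
    p * (∣B∣ m + q ^ m) + 1       ≡⟨ regroup p (∣B∣ m) (q ^ m) ⟩
    (p * ∣B∣ m + 1) + p * q ^ m   ≡⟨ cong (_+ p * q ^ m) (geometric m) ⟩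
    suc p * q ^ m                 ≡⟨ cong (_* q ^ m) q≡suc-p ⟨
    q * q ^ m                     ∎
    where
    open ≡-Reasoning
    regroup : ∀ p b c → p * (b + c) + 1 ≡ (p * b + 1) + p * c
    regroup = ℕ-solve-∀

  prod : Poly F × Poly F → Poly F
  prod (u , v) = u ⊠ v

  _≟ₚ_ : DecidableEquality (Poly F)
  _≟ₚ_ = List.≡-dec (_≟F_ F)

  factorisations : ℕ → Poly F → List (Poly F × Poly F)
  factorisations n s = filter (λ z → s ≟ₚ prod z) (pairs F n)

  ∈-pairs : ∀ {n d e u v} → Monic d u → Monic e v → d ≤ n → e ≤ n → (u , v) ∈ pairs F n
  ∈-pairs U V d≤n e≤n = ∈-cartesianProduct⁺ (∈-monicsBelow U (s≤s d≤n)) (∈-monicsBelow V (s≤s e≤n))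

  record MonicPair (n : ℕ) (z : Poly F × Poly F) : Set where
    constructor monicPair
    field
      {degree₁ degree₂} : ℕ
      monic₁ : Monic degree₁ (proj₁ z)
      monic₂ : Monic degree₂ (proj₂ z)
      bound₁ : degree₁ ≤ n
      bound₂ : degree₂ ≤ n

  pairs-∈ : ∀ {n z} → z ∈ pairs F n → MonicPair n z
  pairs-∈ {n} z∈ with u∈ , v∈ ← ∈-cartesianProduct⁻ (monicsBelow (suc n)) (monicsBelow (suc n)) z∈
    with _ , s≤s d≤n , U ← monicsBelow-∈ {suc n} u∈ | _ , s≤s e≤n , V ← monicsBelow-∈ {suc n} v∈ =
    monicPair U V d≤n e≤n

  Unique-pairs : ∀ n → Unique (pairs F n)
  Unique-pairs n = Unique.cartesianProduct⁺ (Unique-monicsBelow (suc n)) (Unique-monicsBelow (suc n))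

  ∈-factorisations : ∀ {n s z} → z ∈ pairs F n → s ≡ prod z → z ∈ factorisations n s
  ∈-factorisations {s = s} = ∈-filter⁺ (λ z → s ≟ₚ prod z)

  factorisations-∈ : ∀ {n s z} → z ∈ factorisations n s → z ∈ pairs F n × s ≡ prod z
  factorisations-∈ {n} {s} = ∈-filter⁻ (λ z → s ≟ₚ prod z) {xs = pairs F n}

  Unique-factorisations : ∀ n s → Unique (factorisations n s)
  Unique-factorisations n s = Unique.filter⁺ (λ z → s ≟ₚ prod z) (Unique-pairs n)

  ΣΦ ΣΦ² : ℕ → ℕ
  ΣΦ  n = sum (map (λ z → Φ F n (prod z)) (pairs F n))
  ΣΦ² n = sum (map (λ z → Φ F n (prod z) * Φ F n (prod z)) (pairs F n))

  equalProducts : ℕ → List ((Poly F × Poly F) × (Poly F × Poly F))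
  equalProducts n = sigma (pairs F n) (λ z → factorisations n (prod z))

  length-equalProducts : ∀ n → length (equalProducts n) ≡ ΣΦ n
  length-equalProducts n = length-sigma (pairs F n) (λ z → factorisations n (prod z))

  Unique-equalProducts : ∀ n → Unique (equalProducts n)
  Unique-equalProducts n = Unique-sigma (Unique-pairs n) (λ z → Unique-factorisations n (prod z))

  factorisationPairs : ℕ → Poly F → List ((Poly F × Poly F) × (Poly F × Poly F))
  factorisationPairs n s = cartesianProduct (factorisations n s) (factorisations n s)

  -- The square of `Φ` counts ordered pairs of factorisations, so the second moment counts three
  -- factorisations of a common product.
  equalTriples : ℕ → List ((Poly F × Poly F) × ((Poly F × Poly F) × (Poly F × Poly F)))
  equalTriples n = sigma (pairs F n) (λ z → factorisationPairs n (prod z))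

  length-equalTriples : ∀ n → length (equalTriples n) ≡ ΣΦ² n
  length-equalTriples n = trans (length-sigma (pairs F n) (λ z → factorisationPairs n (prod z)))
    (cong sum (List.map-cong
      (λ z → length-× (factorisations n (prod z)) (factorisations n (prod z))) (pairs F n)))

  Unique-equalTriples : ∀ n → Unique (equalTriples n)
  Unique-equalTriples n = Unique-sigma (Unique-pairs n) λ z →
    Unique.cartesianProduct⁺ (Unique-factorisations n (prod z)) (Unique-factorisations n (prod z))

-- First moment: the number of solutions of u v = u′ v′.

module FirstMoment (F : FiniteField) where
  open FiniteField F using (q)
  open Polynomials F
  open Lists
  open import Data.Nat using (_+_; _*_)
  open Refinements F
  open MonicLists F

  equalProducts-∈ : ∀ {n z z′} → (z , z′) ∈ equalProducts n →
                    MonicPair n z × MonicPair n z′ × prod z ≡ prod z′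
  equalProducts-∈ {n} zz′∈ with z∈ , z′∈ ← sigma-∈ {xs = pairs F n} {f = λ z → factorisations n (prod z)} zz′∈ with z′∈ , e ← factorisations-∈ {n} z′∈ =
    pairs-∈ {n} z∈ , pairs-∈ {n} z′∈ , e

  ∈-equalProducts : ∀ {n z z′} → z ∈ pairs F n → z′ ∈ pairs F n → prod z ≡ prod z′ →
                    (z , z′) ∈ equalProducts n
  ∈-equalProducts {n} z∈ z′∈ e = ∈-sigma {f = λ z → factorisations n (prod z)} z∈ (∈-factorisations {n} z′∈ e)

  degree-⊠ : ∀ {d i j u g a} → Monic d u → Monic i g → Monic j a → u ≡ g ⊠ a → i + j ≡ d
  degree-⊠ {d} U G A e = Monic-degree (Monic-⊠ G A) (subst (Monic d) e U)

  N : ℕ → ℕ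
  N n = ∣B∣ (suc n)

  1≤p : 1 ≤ p
  1≤p = ℕ.m<n⇒0<n∸m 1<q

  1≤q^ : ∀ m → 1 ≤ q ^ m
  1≤q^ m = ℕ.≤-trans (ℕ.m≤n+m 1 _) (ℕ.≤-reflexive (geometric m))

  *-cancelˡ-p : ∀ {a b} → p * a ≤ p * b → a ≤ b
  *-cancelˡ-p {a} {b} = ℕ.*-cancelˡ-≤ p {{ℕ.>-nonZero 1≤p}}

  -- This is q^m `∣B∣ (suc n ∸ m)` = `N n` - `∣B∣ m`, multiplied by `p`: q^m times the short
  -- geometric series is the long one without its first m terms.
  geometric-split : ∀ {n m} → m ≤ n → p * (q ^ m * ∣B∣ (suc n ∸ m)) + q ^ m ≡ p * N n + 1
  geometric-split {n} {m} m≤n = begin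
    p * (q ^ m * ∣B∣ (suc n ∸ m)) + q ^ m   ≡⟨ factor p (q ^ m) (∣B∣ (suc n ∸ m)) ⟩
    q ^ m * (p * ∣B∣ (suc n ∸ m) + 1)       ≡⟨ cong (q ^ m *_) (geometric (suc n ∸ m)) ⟩
    q ^ m * q ^ (suc n ∸ m)                 ≡⟨ ℕ.^-distribˡ-+-* q m (suc n ∸ m) ⟨
    q ^ (m + (suc n ∸ m))                   ≡⟨ cong (q ^_) (ℕ.m+[n∸m]≡n (ℕ.m≤n⇒m≤1+n m≤n)) ⟩
    q ^ suc n                               ≡⟨ geometric (suc n) ⟨
    p * N n + 1                             ∎
    where
    open ≡-Reasoning
    factor : ∀ p Q c → p * (Q * c) + Q ≡ Q * (p * c + 1)
    factor = ℕ-solve-∀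

  q^*∣B∣≤N : ∀ {n m} → m ≤ n → q ^ m * ∣B∣ (suc n ∸ m) ≤ N n
  q^*∣B∣≤N {n} {m} m≤n = *-cancelˡ-p (ℕ.+-cancelʳ-≤ 1 _ _ (begin
    p * (q ^ m * ∣B∣ (suc n ∸ m)) + 1       ≤⟨ ℕ.+-monoʳ-≤ _ (1≤q^ m) ⟩
    p * (q ^ m * ∣B∣ (suc n ∸ m)) + q ^ m   ≡⟨ geometric-split m≤n ⟩
    p * N n + 1                             ∎))
    where open ℕ.≤-Reasoning

  -- The deficit of `q ^ m * ∣B∣ (suc n ∸ m)` against `N n` is `∣B∣ m`, and q times that is at most
  -- `N n` because q^(m+1) ≤ q^(n+1).
  qN≤q*q^*∣B∣+N : ∀ {n m} → m ≤ n → q * N n ≤ q * (q ^ m * ∣B∣ (suc n ∸ m)) + N n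
  qN≤q*q^*∣B∣+N {n} {m} m≤n = *-cancelˡ-p (ℕ.+-cancelʳ-≤ q _ _ (begin
    p * (q * N n) + q                ≡⟨ expand p q (N n) ⟩
    q * (p * N n + 1)                ≡⟨ cong (q *_) (geometric-split m≤n) ⟨
    q * (p * X + q ^ m)              ≡⟨ ℕ.*-distribˡ-+ q (p * X) (q ^ m) ⟩
    q * (p * X) + q * q ^ m
      ≤⟨ ℕ.+-monoʳ-≤ (q * (p * X)) (ℕ.^-monoʳ-≤ q {{ℕ.>-nonZero (ℕ.<⇒≤ 1<q)}} (s≤s m≤n)) ⟩
    q * (p * X) + q ^ suc n          ≡⟨ cong (q * (p * X) +_) (geometric (suc n)) ⟨
    q * (p * X) + (p * N n + 1)      ≤⟨ ℕ.+-monoʳ-≤ (q * (p * X)) (ℕ.+-monoʳ-≤ (p * N n) (ℕ.<⇒≤ 1<q)) ⟩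
    q * (p * X) + (p * N n + q)      ≡⟨ regroup p q X (N n) ⟩
    p * (q * X + N n) + q            ∎))
    where
    open ℕ.≤-Reasoning
    X = q ^ m * ∣B∣ (suc n ∸ m)
    expand : ∀ p q N → p * (q * N) + q ≡ q * (p * N + 1)
    expand = ℕ-solve-∀
    regroup : ∀ p q X N → q * (p * X) + (p * N + q) ≡ p * (q * X + N) + q
    regroup = ℕ-solve-∀

  -- The four-number parametrisation of the solutions of u v = u′ v′.
  glue : (Poly F × Poly F) × (Poly F × Poly F) → (Poly F × Poly F) × (Poly F × Poly F)
  glue ((a , b) , (g , h)) = (g ⊠ a , b ⊠ h) , (g ⊠ b , a ⊠ h)

  -- Ties go to the first list: it has deg b ≤ deg a = m, the second deg a < deg b = m.
  pairsOfMaxDegree : ℕ → List (Poly F × Poly F)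
  pairsOfMaxDegree m = cartesianProduct (monicsOfDegree m) (monicsBelow (suc m))
                    ++ cartesianProduct (monicsBelow m) (monicsOfDegree m)

  cofactors : ℕ → ℕ → List (Poly F × Poly F)
  cofactors n m = cartesianProduct (monicsBelow (suc n ∸ m)) (monicsBelow (suc n ∸ m))

  parametersAt : ℕ → ℕ → List ((Poly F × Poly F) × (Poly F × Poly F))
  parametersAt n m = cartesianProduct (pairsOfMaxDegree m) (cofactors n m)

  parameters : ℕ → List (ℕ × ((Poly F × Poly F) × (Poly F × Poly F)))
  parameters n = sigma (upTo (suc n)) (parametersAt n)

  ∈-cofactors : ∀ {n m i l g h} → Monic i g → Monic l h → i + m ≤ n → l + m ≤ n → (g , h) ∈ cofactors n m
  ∈-cofactors {m = m} G H i≤ l≤ = ∈-cartesianProduct⁺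
    (∈-monicsBelow G (ℕ.m+n≤o⇒m≤o∸n _ (s≤s i≤))) (∈-monicsBelow H (ℕ.m+n≤o⇒m≤o∸n _ (s≤s l≤)))

  parametrised : ∀ {n z z′} → MonicPair n z → MonicPair n z′ → prod z ≡ prod z′ →
                 ∃[ y ] y ∈ parameters n × (z , z′) ≡ glue (proj₂ y)
  parametrised {n} {z} {z′} (monicPair U V u≤ v≤) (monicPair U′ V′ u′≤ v′≤) e = go (ℕ.≤-<-connex k j)
    where
    open Refinement (refine U V U′ V′ e)

    eq : (z , z′) ≡ glue ((a , b) , (g , h))
    eq = cong₂ _,_ (cong₂ _,_ u≡ga v≡bh) (cong₂ _,_ w≡gb z≡ah)

    i+j≤n : i + j ≤ n
    i+j≤n = subst (_≤ n) (sym (degree-⊠ U monic-g monic-a u≡ga)) u≤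
    i+k≤n : i + k ≤ n
    i+k≤n = subst (_≤ n) (sym (degree-⊠ U′ monic-g monic-b w≡gb)) u′≤
    l+k≤n : l + k ≤ n
    l+k≤n = subst (_≤ n) (trans (sym (degree-⊠ V monic-b monic-h v≡bh)) (ℕ.+-comm k l)) v≤
    l+j≤n : l + j ≤ n
    l+j≤n = subst (_≤ n) (trans (sym (degree-⊠ V′ monic-a monic-h z≡ah)) (ℕ.+-comm j l)) v′≤

    go : k ≤ j ⊎ j < k → ∃[ y ] y ∈ parameters n × (z , z′) ≡ glue (proj₂ y)
    go (inj₁ k≤j) = (j , ((a , b) , (g , h))) ,
      ∈-sigma {f = parametersAt n} (∈-upTo⁺ (s≤s (ℕ.m+n≤o⇒n≤o i i+j≤n)))
        (∈-cartesianProduct⁺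
          (∈-++⁺ˡ (∈-cartesianProduct⁺ (∈-monicsOfDegree monic-a) (∈-monicsBelow monic-b (s≤s k≤j))))
          (∈-cofactors {n} monic-g monic-h i+j≤n l+j≤n)) , eq
    go (inj₂ j<k) = (k , ((a , b) , (g , h))) ,
      ∈-sigma {f = parametersAt n} (∈-upTo⁺ (s≤s (ℕ.m+n≤o⇒n≤o i i+k≤n)))
        (∈-cartesianProduct⁺
          (∈-++⁺ʳ (cartesianProduct (monicsOfDegree k) (monicsBelow (suc k)))
            (∈-cartesianProduct⁺ (∈-monicsBelow monic-a j<k) (∈-monicsOfDegree monic-b)))
          (∈-cofactors {n} monic-g monic-h i+k≤n l+k≤n)) , eq

  -- Each solution is sent to one of its parametrisations. A parameter determines its solution
  -- through `glue`, so distinct solutions receive distinct parameters.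
  ΣΦ≤∣parameters∣ : ∀ n → ΣΦ n ≤ length (parameters n)
  ΣΦ≤∣parameters∣ n = subst (_≤ length (parameters n)) (length-equalProducts n)
    (length-≤ {R = λ x y → x ≡ glue (proj₂ y)} (equalProducts n) (parameters n) (Unique-equalProducts n)
      (λ x∈ → let Z , Z′ , e = equalProducts-∈ {n} x∈ in parametrised Z Z′ e)
      (λ _ _ e e′ → trans e (sym e′)))

  length-parametersAt : ∀ n m → length (parametersAt n m) ≡
    (q ^ m * ∣B∣ (suc m) + ∣B∣ m * q ^ m) * (∣B∣ (suc n ∸ m) * ∣B∣ (suc n ∸ m))
  length-parametersAt n m = begin
    length (parametersAt n m)
      ≡⟨ length-× (pairsOfMaxDegree m) (cofactors n m) ⟩
    length (pairsOfMaxDegree m) * length (cofactors n m)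
      ≡⟨ cong₂ _*_ (length-++ (cartesianProduct (monicsOfDegree m) (monicsBelow (suc m)))) (length-× (monicsBelow (suc n ∸ m)) (monicsBelow (suc n ∸ m))) ⟩
    (length (cartesianProduct (monicsOfDegree m) (monicsBelow (suc m))) + length (cartesianProduct (monicsBelow m) (monicsOfDegree m))) * (∣B∣ (suc n ∸ m) * ∣B∣ (suc n ∸ m))
      ≡⟨ cong (_* (∣B∣ (suc n ∸ m) * ∣B∣ (suc n ∸ m))) (cong₂ _+_
           (trans (length-× (monicsOfDegree m) (monicsBelow (suc m))) (cong (_* ∣B∣ (suc m)) (length-monicsOfDegree m)))
           (trans (length-× (monicsBelow m) (monicsOfDegree m)) (cong (∣B∣ m *_) (length-monicsOfDegree m)))) ⟩
    (q ^ m * ∣B∣ (suc m) + ∣B∣ m * q ^ m) * (∣B∣ (suc n ∸ m) * ∣B∣ (suc n ∸ m)) ∎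
    where open ≡-Reasoning

  p∣B∣≤ : ∀ m → p * ∣B∣ m ≤ q ^ m
  p∣B∣≤ m = ℕ.≤-trans (ℕ.m≤m+n _ 1) (ℕ.≤-reflexive (geometric m))

  -- At most q^(2m) (q+1)/(q-1) pairs have maximal degree m, by the geometric series for m + 1 and
  -- for m. The factor q^(2m) joins the two cofactors, and each q^m times a cofactor count is at
  -- most `N n`.
  parametersAt-≤ : ∀ {n m} → m ≤ n → p * length (parametersAt n m) ≤ suc q * (N n * N n)
  parametersAt-≤ {n} {m} m≤n = begin
    p * length (parametersAt n m)                        ≡⟨ cong (p *_) (length-parametersAt n m) ⟩
    p * ((Q * ∣B∣ (suc m) + ∣B∣ m * Q) * (c * c))        ≡⟨ regroup p Q (∣B∣ (suc m)) (∣B∣ m) c ⟩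
    (p * ∣B∣ (suc m) + p * ∣B∣ m) * (Q * (c * c))
      ≤⟨ ℕ.*-monoˡ-≤ (Q * (c * c)) (ℕ.+-mono-≤ (p∣B∣≤ (suc m)) (p∣B∣≤ m)) ⟩
    (q * Q + Q) * (Q * (c * c))                          ≡⟨ regroup′ q Q c ⟩
    suc q * ((Q * c) * (Q * c))
      ≤⟨ ℕ.*-monoʳ-≤ (suc q) (ℕ.*-mono-≤ (q^*∣B∣≤N m≤n) (q^*∣B∣≤N m≤n)) ⟩
    suc q * (N n * N n)                                  ∎
    where
    open ℕ.≤-Reasoning
    Q = q ^ m
    c = ∣B∣ (suc n ∸ m)
    regroup : ∀ p Q x y c → p * ((Q * x + y * Q) * (c * c)) ≡ (p * x + p * y) * (Q * (c * c))
    regroup = ℕ-solve-∀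
    regroup′ : ∀ q Q c → (q * Q + Q) * (Q * (c * c)) ≡ suc q * ((Q * c) * (Q * c))
    regroup′ = ℕ-solve-∀

  pΣΦ≤ : ∀ n → p * ΣΦ n ≤ suc n * (suc q * (N n * N n))
  pΣΦ≤ n = begin
    p * ΣΦ n                                                ≤⟨ ℕ.*-monoʳ-≤ p (ΣΦ≤∣parameters∣ n) ⟩
    p * length (parameters n)
      ≡⟨ cong (p *_) (length-sigma (upTo (suc n)) (parametersAt n)) ⟩
    p * sum (map (length ∘ parametersAt n) (upTo (suc n)))
      ≡⟨ sum-map-* p (length ∘ parametersAt n) (upTo (suc n)) ⟨
    sum (map (λ m → p * length (parametersAt n m)) (upTo (suc n)))
      ≤⟨ sum-map-≤ (upTo (suc n)) (λ m∈ → parametersAt-≤ (ℕ.s≤s⁻¹ (∈-upTo⁻ m∈))) ⟩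
    sum (map (λ _ → suc q * (N n * N n)) (upTo (suc n)))    ≡⟨ sum-map-const _ (upTo (suc n)) ⟩
    length (upTo (suc n)) * (suc q * (N n * N n))
      ≡⟨ cong (_* (suc q * (N n * N n))) (List.length-upTo (suc n)) ⟩
    suc n * (suc q * (N n * N n))                           ∎
    where open ℕ.≤-Reasoning

  -- The quotient (q+1)/(q-1) is at most 1 + 4/q: in terms of p = q - 1 this reads p² + 3p + 2 ≤ p²
  -- + 5p, with equality at q = 2.
  qΣΦ≤ : ∀ n → q * ΣΦ n ≤ (q + 4) * suc n * (N n * N n)
  qΣΦ≤ n = *-cancelˡ-p (begin
    p * (q * ΣΦ n)                            ≡⟨ swap-* p q (ΣΦ n) ⟩
    q * (p * ΣΦ n)                            ≤⟨ ℕ.*-monoʳ-≤ q (pΣΦ≤ n) ⟩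
    q * (suc n * (suc q * (N n * N n)))       ≡⟨ regroup q (suc n) (N n * N n) ⟩
    q * suc q * (suc n * (N n * N n))         ≤⟨ ℕ.*-monoˡ-≤ (suc n * (N n * N n)) q[q+1]≤p[q+4] ⟩
    p * (q + 4) * (suc n * (N n * N n))       ≡⟨ regroup′ p (q + 4) (suc n) (N n * N n) ⟩
    p * ((q + 4) * suc n * (N n * N n))       ∎)
    where
    open ℕ.≤-Reasoning
    swap-* : ∀ p q s → p * (q * s) ≡ q * (p * s)
    swap-* = ℕ-solve-∀
    regroup : ∀ q m K → q * (m * (suc q * K)) ≡ q * suc q * (m * K)
    regroup = ℕ-solve-∀
    regroup′ : ∀ p r m K → p * r * (m * K) ≡ p * (r * m * K)
    regroup′ = ℕ-solve-∀
    expandˡ : ∀ p → suc p * suc (suc p) ≡ (p * p + 3 * p) + 2 * 1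
    expandˡ = ℕ-solve-∀
    expandʳ : ∀ p → (p * p + 3 * p) + 2 * p ≡ p * (suc p + 4)
    expandʳ = ℕ-solve-∀
    bound : ∀ {p q} → 1 ≤ p → q ≡ suc p → q * suc q ≤ p * (q + 4)
    bound {p} 1≤p refl = begin
      suc p * suc (suc p)        ≡⟨ expandˡ p ⟩
      (p * p + 3 * p) + 2 * 1    ≤⟨ ℕ.+-monoʳ-≤ (p * p + 3 * p) (ℕ.*-monoʳ-≤ 2 1≤p) ⟩
      (p * p + 3 * p) + 2 * p    ≡⟨ expandʳ p ⟩
      p * (suc p + 4)            ∎
    q[q+1]≤p[q+4] : q * suc q ≤ p * (q + 4)
    q[q+1]≤p[q+4] = bound 1≤p q≡suc-p

  -- First moment, lower bound: coprime pairs of equal degree.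

  _≟₂_ : DecidableEquality (Poly F × Poly F)
  _≟₂_ = Product.≡-dec _≟ₚ_ _≟ₚ_

  open DecMembership _≟₂_ using (_∈?_)

  multiplesAt : ℕ → ℕ → List (Poly F × (Poly F × Poly F))
  multiplesAt i j = cartesianProduct (monicsOfDegree (i ∸ j))
                      (cartesianProduct (monicsOfDegree j) (monicsOfDegree j))

  multiple : ℕ × (Poly F × (Poly F × Poly F)) → Poly F × Poly F
  multiple (_ , d , a , b) = d ⊠ a , d ⊠ b

  -- Pairs (d a, d b) of degree i with deg d = i - j ≥ 1. Coprimality is absence from this list,
  -- which makes it decidable and lets its failures be counted without a gcd.
  nonCoprimePairs : ℕ → List (Poly F × Poly F)
  nonCoprimePairs i = map multiple (sigma (upTo i) (multiplesAt i))

  equidegreePairs : ℕ → List (Poly F × Poly F)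
  equidegreePairs i = cartesianProduct (monicsOfDegree i) (monicsOfDegree i)

  coprime? : ∀ i → Decidable (_∉ nonCoprimePairs i)
  coprime? i x = ¬? (x ∈? nonCoprimePairs i)

  coprimePairs : ℕ → List (Poly F × Poly F)
  coprimePairs i = filter (coprime? i) (equidegreePairs i)

  length-equidegreePairs : ∀ i → length (equidegreePairs i) ≡ q ^ i * q ^ i
  length-equidegreePairs i = trans (length-× (monicsOfDegree i) (monicsOfDegree i))
    (cong₂ _*_ (length-monicsOfDegree i) (length-monicsOfDegree i))

  Unique-equidegreePairs : ∀ i → Unique (equidegreePairs i)
  Unique-equidegreePairs i = Unique.cartesianProduct⁺ (Unique-monicsOfDegree i) (Unique-monicsOfDegree i)

  equidegreePairs-split : ∀ i → q ^ i * q ^ i ≤ length (nonCoprimePairs i) + length (coprimePairs i)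
  equidegreePairs-split i = begin
    q ^ i * q ^ i                                          ≡⟨ length-equidegreePairs i ⟨
    length (equidegreePairs i)
      ≤⟨ length-≤ {R = _≡_} (equidegreePairs i) (nonCoprimePairs i ++ coprimePairs i) (Unique-equidegreePairs i) classify (λ _ _ e e′ → trans e (sym e′)) ⟩
    length (nonCoprimePairs i ++ coprimePairs i)           ≡⟨ length-++ (nonCoprimePairs i) ⟩
    length (nonCoprimePairs i) + length (coprimePairs i)   ∎
    where
    open ℕ.≤-Reasoning
    classify : ∀ {x} → x ∈ equidegreePairs i → ∃[ y ] y ∈ nonCoprimePairs i ++ coprimePairs i × x ≡ y
    classify {x} x∈ with x ∈? nonCoprimePairs i
    ... | yes x∈nc = x , ∈-++⁺ˡ x∈nc , refl
    ... | no  x∉nc = x , ∈-++⁺ʳ (nonCoprimePairs i) (∈-filter⁺ (coprime? i) x∈ x∉nc) , refl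

  -- The sum of q^(i-j) q^(2j) over j < i is q^i `∣B∣ i`, at most the fraction 1/(q-1) of all q^(2i)
  -- pairs.
  p∣nonCoprimePairs∣≤ : ∀ i → p * length (nonCoprimePairs i) ≤ q ^ i * q ^ i
  p∣nonCoprimePairs∣≤ i = begin
    p * length (nonCoprimePairs i)
      ≡⟨ cong (p *_) (trans (length-map multiple (sigma (upTo i) (multiplesAt i))) (length-sigma (upTo i) (multiplesAt i))) ⟩
    p * sum (map (length ∘ multiplesAt i) (upTo i))
      ≤⟨ ℕ.*-monoʳ-≤ p (sum-map-≤ (upTo i) (λ j∈ → ℕ.≤-reflexive (length-multiplesAt (ℕ.<⇒≤ (∈-upTo⁻ j∈))))) ⟩
    p * sum (map (λ j → q ^ i * length (monicsOfDegree j)) (upTo i))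
      ≡⟨ cong (p *_) (sum-map-* (q ^ i) (length ∘ monicsOfDegree) (upTo i)) ⟩
    p * (q ^ i * sum (map (length ∘ monicsOfDegree) (upTo i)))
      ≡⟨ cong (λ s → p * (q ^ i * s)) (length-concatMap monicsOfDegree (upTo i)) ⟨
    p * (q ^ i * ∣B∣ i)                                    ≡⟨ swap-* p (q ^ i) (∣B∣ i) ⟩
    q ^ i * (p * ∣B∣ i)                                    ≤⟨ ℕ.*-monoʳ-≤ (q ^ i) (p∣B∣≤ i) ⟩
    q ^ i * q ^ i                                          ∎
    where
    open ℕ.≤-Reasoning
    swap-* : ∀ p q s → p * (q * s) ≡ q * (p * s)
    swap-* = ℕ-solve-∀
    length-multiplesAt : ∀ {j} → j ≤ i → length (multiplesAt i j) ≡ q ^ i * length (monicsOfDegree j)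
    length-multiplesAt {j} j≤i = begin-equality
      length (multiplesAt i j)
        ≡⟨ length-× (monicsOfDegree (i ∸ j)) (equidegreePairs j) ⟩
      length (monicsOfDegree (i ∸ j)) * length (equidegreePairs j)
        ≡⟨ cong₂ _*_ (length-monicsOfDegree (i ∸ j)) (length-equidegreePairs j) ⟩
      q ^ (i ∸ j) * (q ^ j * q ^ j)                   ≡⟨ ℕ.*-assoc (q ^ (i ∸ j)) (q ^ j) (q ^ j) ⟨
      q ^ (i ∸ j) * q ^ j * q ^ j
        ≡⟨ cong (_* q ^ j) (ℕ.^-distribˡ-+-* q (i ∸ j) j) ⟨
      q ^ (i ∸ j + j) * q ^ j
        ≡⟨ cong₂ (λ m l → q ^ m * l) (ℕ.m∸n+n≡m j≤i) (sym (length-monicsOfDegree j)) ⟩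
      q ^ i * length (monicsOfDegree j)               ∎

  coprimePairs-∈ : ∀ {i a b} → (a , b) ∈ coprimePairs i → Monic i a × Monic i b × (a , b) ∉ nonCoprimePairs i
  coprimePairs-∈ {i} ab∈ with ab∈′ , ∉nc ← ∈-filter⁻ (coprime? i) {xs = equidegreePairs i} ab∈
    with a∈ , b∈ ← ∈-cartesianProduct⁻ (monicsOfDegree i) (monicsOfDegree i) ab∈′ =
    monicsOfDegree-∈ a∈ , monicsOfDegree-∈ b∈ , ∉nc

  -- A common divisor of positive degree would put the pair into `nonCoprimePairs`; the cofactors
  -- have equal degrees because `a` and `b` do.
  commonDivisor≡𝟙 : ∀ {i a b k j j′ d a′ b′} → (a , b) ∈ coprimePairs i → Monic k d → Monic j a′ → Monic j′ b′ →
                    a ≡ d ⊠ a′ → b ≡ d ⊠ b′ → d ≡ 𝟙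
  commonDivisor≡𝟙 ab∈ one _ _ _ _ = refl
  commonDivisor≡𝟙 {i} {k = suc k} {j} {j′} {d} {a′} {b′} ab∈ D@(_ ∷ _) A′ B′ refl refl
    with A , B , ∉nc ← coprimePairs-∈ {i} ab∈
    with refl ← Monic-degree (Monic-⊠ D A′) A
    with refl ← ℕ.+-cancelˡ-≡ (suc k) j′ j (Monic-degree (Monic-⊠ D B′) B) =
    ⊥-elim (∉nc (∈-map⁺ multiple (∈-sigma {f = multiplesAt i} (∈-upTo⁺ (s≤s (ℕ.m≤n+m j k)))
      (∈-cartesianProduct⁺
        (∈-monicsOfDegree (subst (λ e → Monic e d) (sym (ℕ.m+n∸n≡m (suc k) j)) D))
        (∈-cartesianProduct⁺ (∈-monicsOfDegree A′) (∈-monicsOfDegree B′))))))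

  Monic-⊠-comm : ∀ {d e f g} → Monic d f → Monic e g → f ⊠ g ≡ g ⊠ f
  Monic-⊠-comm {f = f} {g} M M′ = Monic-≈⇒≡ (Monic-⊠ M M′) (Monic-⊠ M′ M) (⊠-comm f g)

  Monic-cancelʳ : ∀ {d e k f g w} → Monic d f → Monic e g → Monic k w → f ⊠ w ≡ g ⊠ w → f ≡ g
  Monic-cancelʳ {f = f} {g} {w} M M′ W e = Monic-≈⇒≡ M M′
    (⊠-cancelˡ W (≈-trans (⊠-comm w f) (≈-trans (≡⇒≈ e) (⊠-comm g w))))

  -- As fractions, a/b and a′/b′ both equal u/u′. This eliminates the cofactors g and g′ before
  -- coprimality is applied.
  cross-multiply : ∀ {i i′ k k′ a b a′ b′ g g′} → Monic i a → Monic i b → Monic i′ a′ → Monic i′ b′ →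
                   Monic k g → Monic k′ g′ → g ⊠ a ≡ g′ ⊠ a′ → g ⊠ b ≡ g′ ⊠ b′ → a ⊠ b′ ≡ a′ ⊠ b
  cross-multiply {a = a} {b} {a′} {b′} {g} {g′} A B A′ B′ G G′ e f =
    Monic-≈⇒≡ (Monic-⊠ A B′) (Monic-⊠ A′ B) (⊠-cancelˡ (Monic-⊠ G G′) (begin
      (g ⊠ g′) ⊠ (a ⊠ b′)    ≈⟨ interchange g g′ a b′ ⟩
      (g ⊠ a) ⊠ (g′ ⊠ b′)    ≈⟨ ≡⇒≈ (cong₂ _⊠_ e (sym f)) ⟩
      (g′ ⊠ a′) ⊠ (g ⊠ b)    ≈⟨ interchange g′ g a′ b ⟨
      (g′ ⊠ g) ⊠ (a′ ⊠ b)    ≈⟨ ⊠-congˡ (a′ ⊠ b) (⊠-comm g′ g) ⟩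
      (g ⊠ g′) ⊠ (a′ ⊠ b)    ∎))
    where
    open ≈-Reasoning
    open 𝔽[x]-Solver using (solve; _:*_; _:=_)
    interchange : ∀ s t x y → (s ⊠ t) ⊠ (x ⊠ y) ≈ (s ⊠ x) ⊠ (t ⊠ y)
    interchange = solve 4 (λ s t x y → (s :* t) :* (x :* y) := (s :* x) :* (t :* y)) ≈-refl

  -- Refining a b′ = a′ b gives a = g r, b′ = s h, a′ = g s, b = r h. Here r divides a and b, and s
  -- divides a′ and b′, so both are 1.
  coprime-unique : ∀ {i i′ a b a′ b′} → (a , b) ∈ coprimePairs i → (a′ , b′) ∈ coprimePairs i′ →
                   a ⊠ b′ ≡ a′ ⊠ b → a ≡ a′ × b ≡ b′
  coprime-unique {i} {i′} ab∈ ab′∈ e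
    with A , B , _ ← coprimePairs-∈ {i} ab∈ | A′ , B′ , _ ← coprimePairs-∈ {i′} ab′∈
    with record { monic-g = G ; monic-a = R ; monic-b = S ; monic-h = H
                ; u≡ga = a≡gr ; v≡bh = b′≡sh ; w≡gb = a′≡gs ; z≡ah = b≡rh } ← refine A B′ A′ B e
    with refl ← commonDivisor≡𝟙 {i} ab∈ R G H (trans a≡gr (Monic-⊠-comm G R)) b≡rh
    with refl ← commonDivisor≡𝟙 {i′} ab′∈ S G H (trans a′≡gs (Monic-⊠-comm G S)) b′≡sh =
    trans a≡gr (sym a′≡gs) , trans b≡rh (sym b′≡sh)

  coprimeParametersAt : ℕ → ℕ → List ((Poly F × Poly F) × (Poly F × Poly F))
  coprimeParametersAt n i = cartesianProduct (coprimePairs i) (cofactors n i)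

  coprimeParameters : ℕ → List (ℕ × ((Poly F × Poly F) × (Poly F × Poly F)))
  coprimeParameters n = sigma (upTo (suc n)) (coprimeParametersAt n)

  Unique-coprimeParameters : ∀ n → Unique (coprimeParameters n)
  Unique-coprimeParameters n = Unique-sigma (Unique.upTo⁺ (suc n)) λ i → Unique.cartesianProduct⁺
    (Unique.filter⁺ (coprime? i) (Unique-equidegreePairs i))
    (Unique.cartesianProduct⁺ (Unique-monicsBelow (suc n ∸ i)) (Unique-monicsBelow (suc n ∸ i)))

  record CoprimeParameter (n i : ℕ) (a b g h : Poly F) : Set where
    field
      coprime : (a , b) ∈ coprimePairs i
      {k l} : ℕ
      monic-a : Monic i a
      monic-b : Monic i b
      monic-g : Monic k g
      monic-h : Monic l h
      k+i≤n : k + i ≤ n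
      l+i≤n : l + i ≤ n

  coprimeParameters-∈ : ∀ {n i a b g h} → (i , ((a , b) , (g , h))) ∈ coprimeParameters n →
                        CoprimeParameter n i a b g h
  coprimeParameters-∈ {n} {i} x∈
    with i∈ , x∈′ ← sigma-∈ {xs = upTo (suc n)} {f = coprimeParametersAt n} x∈
    with ab∈ , gh∈ ← ∈-cartesianProduct⁻ (coprimePairs i) (cofactors n i) x∈′
    with g∈ , h∈ ← ∈-cartesianProduct⁻ (monicsBelow (suc n ∸ i)) (monicsBelow (suc n ∸ i)) gh∈
    with A , B , _ ← coprimePairs-∈ {i} ab∈
    with _ , k< , G ← monicsBelow-∈ {suc n ∸ i} g∈ | _ , l< , H ← monicsBelow-∈ {suc n ∸ i} h∈ = record
    { coprime = ab∈ ; monic-a = A ; monic-b = B ; monic-g = G ; monic-h = H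
    ; k+i≤n = ℕ.s≤s⁻¹ (ℕ.m≤o∸n⇒m+n≤o _ (∈-upTo⁻′ i∈) k<) ; l+i≤n = ℕ.s≤s⁻¹ (ℕ.m≤o∸n⇒m+n≤o _ (∈-upTo⁻′ i∈) l<) }
    where
    ∈-upTo⁻′ : ∀ {n i} → i ∈ upTo n → i ≤ n
    ∈-upTo⁻′ = ℕ.<⇒≤ ∘ ∈-upTo⁻

  -- `glue` is injective on these parameters: u and u′ determine (a, b), and then g and h follow by
  -- cancellation.
  ∣coprimeParameters∣≤ΣΦ : ∀ n → length (coprimeParameters n) ≤ ΣΦ n
  ∣coprimeParameters∣≤ΣΦ n = subst (length (coprimeParameters n) ≤_) (length-equalProducts n)
    (length-≤ {R = λ x y → y ≡ glue (proj₂ x)} (coprimeParameters n) (equalProducts n)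
      (Unique-coprimeParameters n) total injective)
    where
    total : ∀ {x} → x ∈ coprimeParameters n → ∃[ y ] y ∈ equalProducts n × y ≡ glue (proj₂ x)
    total {i , (a , b) , (g , h)} x∈ = _ , ∈-equalProducts {n}
        (∈-pairs {n} (Monic-⊠ monic-g monic-a) (Monic-⊠ monic-b monic-h) k+i≤n i+l≤n)
        (∈-pairs {n} (Monic-⊠ monic-g monic-b) (Monic-⊠ monic-a monic-h) k+i≤n i+l≤n)
        (Monic-≈⇒≡ (Monic-⊠ (Monic-⊠ monic-g monic-a) (Monic-⊠ monic-b monic-h))
                   (Monic-⊠ (Monic-⊠ monic-g monic-b) (Monic-⊠ monic-a monic-h))
                   (solve 4 (λ g a b h → (g :* a) :* (b :* h) := (g :* b) :* (a :* h)) ≈-refl g a b h))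
        , refl
      where
      open CoprimeParameter (coprimeParameters-∈ {n} {i} {a} {b} {g} {h} x∈)
      open 𝔽[x]-Solver using (solve; _:*_; _:=_)
      i+l≤n : i + l ≤ n
      i+l≤n = subst (_≤ n) (ℕ.+-comm l i) l+i≤n

    injective : ∀ {x x′ y} → x ∈ coprimeParameters n → x′ ∈ coprimeParameters n →
                y ≡ glue (proj₂ x) → y ≡ glue (proj₂ x′) → x ≡ x′
    injective {i , (a , b) , (g , h)} {i′ , (a′ , b′) , (g′ , h′)} x∈ x′∈ refl e = conclude
      (coprime-unique {i} {i′} X.coprime X′.coprime (cross-multiply X.monic-a X.monic-b X′.monic-a X′.monic-b X.monic-g X′.monic-g
        (cong (proj₁ ∘ proj₁) e) (cong (proj₁ ∘ proj₂) e)))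
      where
      module X  = CoprimeParameter (coprimeParameters-∈ {n} {i} {a} {b} {g} {h} x∈)
      module X′ = CoprimeParameter (coprimeParameters-∈ {n} {i′} {a′} {b′} {g′} {h′} x′∈)
      assemble : ∀ {a b g h i a′ b′ g′ h′ i′} → i ≡ i′ → a ≡ a′ → b ≡ b′ → g ≡ g′ → h ≡ h′ →
                 _≡_ {A = ℕ × ((Poly F × Poly F) × (Poly F × Poly F))}
                   (i , (a , b) , (g , h)) (i′ , (a′ , b′) , (g′ , h′))
      assemble refl refl refl refl refl = refl
      conclude : a ≡ a′ × b ≡ b′ → (i , (a , b) , (g , h)) ≡ (i′ , (a′ , b′) , (g′ , h′))
      conclude (a≡a′ , b≡b′) = assemble
        (Monic-degree X.monic-a (subst (Monic i′) (sym a≡a′) X′.monic-a)) a≡a′ b≡b′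
        (Monic-cancelʳ X.monic-g X′.monic-g X.monic-a
          (trans (cong (proj₁ ∘ proj₁) e) (cong (g′ ⊠_) (sym a≡a′))))
        (Monic-cancelʳ X.monic-h X′.monic-h X.monic-b
          (trans (Monic-⊠-comm X.monic-h X.monic-b) (trans (cong (proj₂ ∘ proj₁) e)
            (trans (cong (_⊠ h′) (sym b≡b′)) (Monic-⊠-comm X.monic-b X′.monic-h)))))

  q≤2p : q ≤ 2 * p
  q≤2p = begin
    q           ≡⟨ q≡suc-p ⟩
    1 + p       ≤⟨ ℕ.+-monoˡ-≤ p 1≤p ⟩
    p + p       ≡⟨ cong (p +_) (ℕ.+-identityʳ p) ⟨
    2 * p       ∎
    where open ℕ.≤-Reasoning

  -- The 4 collects four losses of M²/q: one for each of the two replacements of M by X = q^i c, and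
  -- two for the non-coprime pairs, whose share 1/(q-1) is at most 2/q.
  coprimeParametersAt-≥ : ∀ {n i} → i ≤ n →
    q * (N n * N n) ≤ q * length (coprimeParametersAt n i) + 4 * (N n * N n)
  coprimeParametersAt-≥ {n} {i} i≤n = begin
    q * (M * M)                                       ≡⟨ ℕ.*-assoc q M M ⟨
    q * M * M                                         ≤⟨ ℕ.*-monoˡ-≤ M qM≤ ⟩
    (q * X + M) * M                                   ≡⟨ step₁ q X M ⟩
    X * (q * M) + M * M                               ≤⟨ ℕ.+-monoˡ-≤ (M * M) (ℕ.*-monoʳ-≤ X qM≤) ⟩
    X * (q * X + M) + M * M                           ≡⟨ step₂ q X M ⟩
    q * (X * X) + (X * M + M * M)
      ≤⟨ ℕ.+-monoʳ-≤ (q * (X * X)) (ℕ.+-monoˡ-≤ (M * M) (ℕ.*-monoˡ-≤ M X≤M)) ⟩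
    q * (X * X) + (M * M + M * M)                     ≡⟨ cong (_+ (M * M + M * M)) (step₃ q Q c) ⟩
    Q * Q * (q * (c * c)) + (M * M + M * M)
      ≤⟨ ℕ.+-monoˡ-≤ (M * M + M * M) (ℕ.*-monoˡ-≤ (q * (c * c)) (equidegreePairs-split i)) ⟩
    (nc + cp) * (q * (c * c)) + (M * M + M * M)
      ≡⟨ cong (_+ (M * M + M * M)) (ℕ.*-distribʳ-+ (q * (c * c)) nc cp) ⟩
    nc * (q * (c * c)) + cp * (q * (c * c)) + (M * M + M * M)
      ≤⟨ ℕ.+-monoˡ-≤ (M * M + M * M) (ℕ.+-monoˡ-≤ (cp * (q * (c * c))) nc-≤) ⟩
    2 * (M * M) + cp * (q * (c * c)) + (M * M + M * M) ≡⟨ step₄ q cp (c * c) (M * M) ⟩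
    q * (cp * (c * c)) + 4 * (M * M)                  ≡⟨ cong (λ l → q * l + 4 * (M * M)) length-at ⟨
    q * length (coprimeParametersAt n i) + 4 * (M * M) ∎
    where
    open ℕ.≤-Reasoning
    M = N n
    Q = q ^ i
    c = ∣B∣ (suc n ∸ i)
    X = Q * c
    nc = length (nonCoprimePairs i)
    cp = length (coprimePairs i)
    qM≤ : q * M ≤ q * X + M
    qM≤ = qN≤q*q^*∣B∣+N i≤n
    X≤M : X ≤ M
    X≤M = q^*∣B∣≤N i≤n
    step₁ : ∀ q X M → (q * X + M) * M ≡ X * (q * M) + M * M
    step₁ = ℕ-solve-∀
    step₂ : ∀ q X M → X * (q * X + M) + M * M ≡ q * (X * X) + (X * M + M * M)
    step₂ = ℕ-solve-∀
    step₃ : ∀ q Q c → q * (Q * c * (Q * c)) ≡ Q * Q * (q * (c * c))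
    step₃ = ℕ-solve-∀
    step₄ : ∀ q cp cc K → 2 * K + cp * (q * cc) + (K + K) ≡ q * (cp * cc) + 4 * K
    step₄ = ℕ-solve-∀
    step₅ : ∀ p K → 2 * p * K ≡ p * (2 * K)
    step₅ = ℕ-solve-∀
    nc-≤ : nc * (q * (c * c)) ≤ 2 * (M * M)
    nc-≤ = *-cancelˡ-p (begin
      p * (nc * (q * (c * c)))      ≡⟨ ℕ.*-assoc p nc (q * (c * c)) ⟨
      p * nc * (q * (c * c))        ≤⟨ ℕ.*-monoˡ-≤ (q * (c * c)) (p∣nonCoprimePairs∣≤ i) ⟩
      Q * Q * (q * (c * c))         ≡⟨ step₃ q Q c ⟨
      q * (X * X)                   ≤⟨ ℕ.*-mono-≤ q≤2p (ℕ.*-mono-≤ X≤M X≤M) ⟩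
      2 * p * (M * M)               ≡⟨ step₅ p (M * M) ⟩
      p * (2 * (M * M))             ∎)
    length-at : length (coprimeParametersAt n i) ≡ cp * (c * c)
    length-at = trans (length-× (coprimePairs i) (cofactors n i))
      (cong (cp *_) (length-× (monicsBelow (suc n ∸ i)) (monicsBelow (suc n ∸ i))))

  qΣΦ≥ : ∀ n → q * suc n * (N n * N n) ≤ q * ΣΦ n + 4 * suc n * (N n * N n)
  qΣΦ≥ n = begin
    q * suc n * K                       ≡⟨ step₁ q (suc n) K ⟩
    suc n * (q * K)                     ≡⟨ cong (_* (q * K)) (List.length-upTo (suc n)) ⟨
    length is * (q * K)                 ≡⟨ sum-map-const (q * K) is ⟨
    sum (map (λ _ → q * K) is)
      ≤⟨ sum-map-≤ is (λ i∈ → coprimeParametersAt-≥ (ℕ.s≤s⁻¹ (∈-upTo⁻ i∈))) ⟩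
    sum (map (λ i → q * L i + 4 * K) is) ≡⟨ sum-map-+ (λ i → q * L i) (λ _ → 4 * K) is ⟩
    sum (map (λ i → q * L i) is) + sum (map (λ _ → 4 * K) is)
      ≡⟨ cong₂ _+_ (sum-map-* q L is) (trans (sum-map-const (4 * K) is) (cong (_* (4 * K)) (List.length-upTo (suc n)))) ⟩
    q * sum (map L is) + suc n * (4 * K)
      ≡⟨ cong₂ (λ l r → q * l + r) (sym (length-sigma is (coprimeParametersAt n))) (step₂ (suc n) K) ⟩
    q * length (coprimeParameters n) + 4 * suc n * K
      ≤⟨ ℕ.+-monoˡ-≤ (4 * suc n * K) (ℕ.*-monoʳ-≤ q (∣coprimeParameters∣≤ΣΦ n)) ⟩
    q * ΣΦ n + 4 * suc n * K            ∎
    where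
    open ℕ.≤-Reasoning
    K = N n * N n
    is = upTo (suc n)
    L = length ∘ coprimeParametersAt n
    step₁ : ∀ q m K → q * m * K ≡ m * (q * K)
    step₁ = ℕ-solve-∀
    step₂ : ∀ m K → m * (4 * K) ≡ 4 * m * K
    step₂ = ℕ-solve-∀

-- Second moment: common refinements of three factorisations.

module SecondMoment (F : FiniteField) where
  open FiniteField F using (q)
  open Polynomials F
  open Lists
  open import Data.Nat using (_+_; _*_)
  open Refinements F
  open MonicLists F
  open FirstMoment F

  monicTuples : ∀ {k} → Vec ℕ k → List (Vec (Poly F) k)
  monicTuples []       = [] ∷ []
  monicTuples (d ∷ ds) = cartesianProductWith _∷_ (monicsOfDegree d) (monicTuples ds)

  length-monicTuples : ∀ {k} (ds : Vec ℕ k) → length (monicTuples ds) ≡ q ^ Vec.sum ds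
  length-monicTuples []       = refl
  length-monicTuples (d ∷ ds) = begin
    length (monicTuples (d ∷ ds))
      ≡⟨ length-cartesianProductWith (monicsOfDegree d) ⟩
    length (monicsOfDegree d) * length (monicTuples ds)
      ≡⟨ cong₂ _*_ (length-monicsOfDegree d) (length-monicTuples ds) ⟩
    q ^ d * q ^ Vec.sum ds                                   ≡⟨ ℕ.^-distribˡ-+-* q d (Vec.sum ds) ⟨
    q ^ (d + Vec.sum ds)                                     ∎
    where
    open ≡-Reasoning
    length-cartesianProductWith : ∀ fs →
      length (cartesianProductWith _∷_ fs (monicTuples ds)) ≡ length fs * length (monicTuples ds)
    length-cartesianProductWith []       = refl
    length-cartesianProductWith (f ∷ fs) = trans (length-++ (map (f ∷_) (monicTuples ds)))
      (cong₂ _+_ (length-map (f ∷_) (monicTuples ds)) (length-cartesianProductWith fs))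

  data MonicTuple : ∀ {k} → Vec ℕ k → Vec (Poly F) k → Set where
    []  : MonicTuple [] []
    _∷_ : ∀ {k d f} {ds : Vec ℕ k} {fs} → Monic d f → MonicTuple ds fs → MonicTuple (d ∷ ds) (f ∷ fs)

  ∈-monicTuples : ∀ {k} {ds : Vec ℕ k} {fs} → MonicTuple ds fs → fs ∈ monicTuples ds
  ∈-monicTuples []       = here refl
  ∈-monicTuples (M ∷ Ms) = ∈-cartesianProductWith⁺ _∷_ (∈-monicsOfDegree M) (∈-monicTuples Ms)

  -- `degrees` uses truncated subtraction, so some data yield degrees that do not add up to deg u +
  -- deg v. Discarding these leaves at most q^σ tuples for every datum.
  guarded : ∀ {k} → ℕ → Vec ℕ k → List (Vec (Poly F) k)
  guarded σ ds with Vec.sum ds ℕ.≟ σ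
  ... | yes _ = monicTuples ds
  ... | no  _ = []

  length-guarded : ∀ {k} σ (ds : Vec ℕ k) → length (guarded σ ds) ≤ q ^ σ
  length-guarded σ ds with Vec.sum ds ℕ.≟ σ
  ... | yes refl = ℕ.≤-reflexive (length-monicTuples ds)
  ... | no  _    = z≤n

  ∈-guarded : ∀ {k σ} {ds : Vec ℕ k} {fs} → Vec.sum ds ≡ σ → fs ∈ monicTuples ds → fs ∈ guarded σ ds
  ∈-guarded {σ = σ} {ds} e fs∈ with Vec.sum ds ℕ.≟ σ
  ... | yes _ = fs∈
  ... | no ¬e = ⊥-elim (¬e e)

  Triple : Set
  Triple = (Poly F × Poly F) × ((Poly F × Poly F) × (Poly F × Poly F))

  -- The common refinement of three factorisations: the factors are indexed by {0,1}³, and the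
  -- first (second) factor of the j-th factorisation collects the indices with j-th digit 0 (1).
  combine : Vec (Poly F) 8 → Triple
  combine (r ∷ s ∷ t ∷ w ∷ r′ ∷ s′ ∷ t′ ∷ w′ ∷ []) =
    ((r ⊠ s) ⊠ (t ⊠ w) , (r′ ⊠ s′) ⊠ (t′ ⊠ w′)) ,
    (((r ⊠ s) ⊠ (r′ ⊠ s′) , (t ⊠ w) ⊠ (t′ ⊠ w′)) , ((r ⊠ t) ⊠ (r′ ⊠ t′) , (s ⊠ w) ⊠ (s′ ⊠ w′)))

  DegreeData : Set
  DegreeData = ℕ × (ℕ × (ℕ × (ℕ × (ℕ × ℕ))))

  -- x, y, x′, x″ are the defects n - deg of u, v, u′, u″; four of the eight degrees are free.
  degrees : ℕ → ℕ → ℕ → DegreeData → Vec ℕ 8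
  degrees n x y (x′ , x″ , i , j , k , l) =
    i ∷ j ∷ k ∷ (α ∸ (i + j) ∸ k) ∷ l ∷ s′ ∷ t′ ∷ (β ∸ (l + s′) ∸ t′) ∷ []
    where
    α = n ∸ x
    β = n ∸ y
    s′ = n ∸ x′ ∸ (i + j) ∸ l
    t′ = n ∸ x″ ∸ (i + k) ∸ l

  -- By `defect-≤` the defects of u′ and u″ are at most x + y. Letting them range up to n instead
  -- would cost a further factor of order n².
  degreeData : ℕ → ℕ → ℕ → List DegreeData
  degreeData n x y =
    cartesianProduct defects (cartesianProduct defects
      (cartesianProduct frees (cartesianProduct frees (cartesianProduct frees frees))))
    where
    defects = upTo (suc (x + y))
    frees = upTo (suc n)

  length-degreeData : ∀ n x y →
    length (degreeData n x y) ≡ suc (x + y) * (suc (x + y) * (suc n * (suc n * (suc n * suc n))))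
  length-degreeData n x y =
    trans (length-× d (cartesianProduct d f⁴)) (cong₂ _*_ (List.length-upTo (suc (x + y)))
      (trans (length-× d f⁴) (cong₂ _*_ (List.length-upTo (suc (x + y)))
        (trans (length-× f f³) (cong₂ _*_ ∣f∣ (trans (length-× f f²) (cong₂ _*_ ∣f∣
          (trans (length-× f f) (cong₂ _*_ ∣f∣ ∣f∣)))))))))
    where
    d = upTo (suc (x + y))
    f = upTo (suc n)
    f² = cartesianProduct f f
    f³ = cartesianProduct f f²
    f⁴ = cartesianProduct f f³
    ∣f∣ = List.length-upTo (suc n)

  tuples : ℕ → ℕ → ℕ → DegreeData → List (Vec (Poly F) 8)
  tuples n x y c = guarded ((n ∸ x) + (n ∸ y)) (degrees n x y c)

  tuplesAt₂ : ℕ → ℕ → ℕ → List (Vec (Poly F) 8)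
  tuplesAt₂ n x y = concatMap (tuples n x y) (degreeData n x y)

  tuplesAt₁ : ℕ → ℕ → List (Vec (Poly F) 8)
  tuplesAt₁ n x = concatMap (tuplesAt₂ n x) (upTo (suc n))

  allTuples : ℕ → List (Vec (Poly F) 8)
  allTuples n = concatMap (tuplesAt₁ n) (upTo (suc n))

  record Cube (z z′ z″ : Poly F × Poly F) : Set where
    field
      {ir is it iw ir′ is′ it′ iw′} : ℕ
      {r s t w r′ s′ t′ w′} : Poly F
      R  : Monic ir r
      S  : Monic is s
      T  : Monic it t
      W  : Monic iw w
      R′ : Monic ir′ r′
      S′ : Monic is′ s′
      T′ : Monic it′ t′
      W′ : Monic iw′ w′
      combines : (z , (z′ , z″)) ≡ combine (r ∷ s ∷ t ∷ w ∷ r′ ∷ s′ ∷ t′ ∷ w′ ∷ [])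

  -- Refining u v = u′ v′ and u v = u″ v″ factors u in two ways and v in two ways. Refining these
  -- two equations in turn gives four factors of u and four of v, from which u′, v′, u″ and v″ are
  -- regrouped.
  cube : ∀ {n z z′ z″} → MonicPair n z → MonicPair n z′ → MonicPair n z″ →
         prod z ≡ prod z′ → prod z ≡ prod z″ → Cube z z′ z″
  cube (monicPair U V _ _) (monicPair U′ V′ _ _) (monicPair U″ V″ _ _) e′ e″
    with record { monic-g = G ; monic-a = A ; monic-b = B ; monic-h = H
                ; u≡ga = refl ; v≡bh = refl ; w≡gb = refl ; z≡ah = refl } ← refine U V U′ V′ e′
    with record { monic-g = G₂ ; monic-a = A₂ ; monic-b = B₂ ; monic-h = H₂
                ; u≡ga = u≡₂ ; v≡bh = v≡₂ ; w≡gb = refl ; z≡ah = refl } ← refine U V U″ V″ e″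
    with record { monic-g = R ; monic-a = S ; monic-b = T ; monic-h = W
                ; u≡ga = refl ; v≡bh = refl ; w≡gb = refl ; z≡ah = refl } ← refine G A G₂ A₂ u≡₂
    with record { monic-g = R′ ; monic-a = S′ ; monic-b = T′ ; monic-h = W′
                ; u≡ga = refl ; v≡bh = refl ; w≡gb = refl ; z≡ah = refl } ← refine B H B₂ H₂ v≡₂ =
    record { R = R ; S = S ; T = T ; W = W ; R′ = R′ ; S′ = S′ ; T′ = T′ ; W′ = W′ ; combines = refl }

  -- The defects of a′ and b′ have the same sum as those of a and b, and the defect of b′ is not
  -- negative.
  defect-≤ : ∀ {n a b a′ b′} → a ≤ n → b ≤ n → b′ ≤ n → a + b ≡ a′ + b′ → n ∸ a′ ≤ (n ∸ a) + (n ∸ b)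
  defect-≤ {n} {a} {b} {a′} {b′} a≤n b≤n b′≤n e = ℕ.m≤n+o⇒m∸n≤o n a′ (ℕ.+-cancelʳ-≤ n _ _ (begin
    n + n                                      ≡⟨ cong₂ _+_ (ℕ.m+[n∸m]≡n a≤n) (ℕ.m+[n∸m]≡n b≤n) ⟨
    (a + (n ∸ a)) + (b + (n ∸ b))              ≡⟨ interchange a (n ∸ a) b (n ∸ b) ⟩
    (a + b) + ((n ∸ a) + (n ∸ b))              ≡⟨ cong (_+ ((n ∸ a) + (n ∸ b))) e ⟩
    (a′ + b′) + ((n ∸ a) + (n ∸ b))            ≡⟨ regroup a′ b′ _ ⟩
    (a′ + ((n ∸ a) + (n ∸ b))) + b′            ≤⟨ ℕ.+-monoʳ-≤ _ b′≤n ⟩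
    (a′ + ((n ∸ a) + (n ∸ b))) + n             ∎))
    where
    open ℕ.≤-Reasoning
    interchange : ∀ a b c d → (a + b) + (c + d) ≡ (a + c) + (b + d)
    interchange = ℕ-solve-∀
    regroup : ∀ a b c → (a + b) + c ≡ (a + c) + b
    regroup = ℕ-solve-∀

  module _ {n ir is it iw ir′ is′ it′ iw′ : ℕ}
    (u≤ : (ir + is) + (it + iw) ≤ n) (v≤ : (ir′ + is′) + (it′ + iw′) ≤ n)
    (u′≤ : (ir + is) + (ir′ + is′) ≤ n) (v′≤ : (it + iw) + (it′ + iw′) ≤ n)
    (u″≤ : (ir + it) + (ir′ + it′) ≤ n) (v″≤ : (is + iw) + (is′ + iw′) ≤ n) where

    private
      x y : ℕ
      x  = n ∸ ((ir + is) + (it + iw))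
      y  = n ∸ ((ir′ + is′) + (it′ + iw′))

      datum : DegreeData
      datum = n ∸ ((ir + is) + (ir′ + is′)) , n ∸ ((ir + it) + (ir′ + it′)) , ir , is , it , ir′

      ds : Vec ℕ 8
      ds = ir ∷ is ∷ it ∷ iw ∷ ir′ ∷ is′ ∷ it′ ∷ iw′ ∷ []

      last : ∀ a b c → (a + (b + c)) ∸ a ∸ b ≡ c
      last a b c = trans (cong (_∸ b) (ℕ.m+n∸m≡n a (b + c))) (ℕ.m+n∸m≡n b c)

    -- For a datum read off an actual refinement no subtraction truncates, so all eight degrees are
    -- recovered from the four defects and the four free degrees.
    degrees-datum : degrees n x y datum ≡ ds
    degrees-datum
      rewrite ℕ.m∸[m∸n]≡n u≤ | ℕ.m∸[m∸n]≡n v≤ | ℕ.m∸[m∸n]≡n u′≤ | ℕ.m∸[m∸n]≡n u″≤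
            | last (ir + is) it iw | last (ir + is) ir′ is′ | last (ir + it) ir′ it′
            | last (ir′ + is′) it′ iw′ = refl

    sum-degrees : Vec.sum (degrees n x y datum) ≡ (n ∸ x) + (n ∸ y)
    sum-degrees = trans (cong Vec.sum degrees-datum) (trans (regroup ir is it iw ir′ is′ it′ iw′)
      (sym (cong₂ _+_ (ℕ.m∸[m∸n]≡n u≤) (ℕ.m∸[m∸n]≡n v≤))))
      where
      regroup : ∀ a b c d e f g h → a + (b + (c + (d + (e + (f + (g + (h + 0)))))))
                                  ≡ ((a + b) + (c + d)) + ((e + f) + (g + h))
      regroup = ℕ-solve-∀

    ∈-degreeData : datum ∈ degreeData n x y
    ∈-degreeData =
      ∈-cartesianProduct⁺ (∈-upTo⁺ (s≤s (defect-≤ {a′ = (ir + is) + (ir′ + is′)} u≤ v≤ v′≤ (e₁ ir is it iw ir′ is′ it′ iw′))))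
        (∈-cartesianProduct⁺ (∈-upTo⁺ (s≤s (defect-≤ {a′ = (ir + it) + (ir′ + it′)} u≤ v≤ v″≤ (e₂ ir is it iw ir′ is′ it′ iw′))))
          (∈-cartesianProduct⁺ (∈-upTo⁺ (s≤s (ℕ.m+n≤o⇒m≤o ir (ℕ.m+n≤o⇒m≤o (ir + is) u≤))))
            (∈-cartesianProduct⁺ (∈-upTo⁺ (s≤s (ℕ.m+n≤o⇒n≤o ir (ℕ.m+n≤o⇒m≤o (ir + is) u≤))))
              (∈-cartesianProduct⁺ (∈-upTo⁺ (s≤s (ℕ.m+n≤o⇒m≤o it (ℕ.m+n≤o⇒n≤o (ir + is) u≤))))
                (∈-upTo⁺ (s≤s (ℕ.m+n≤o⇒m≤o ir′ (ℕ.m+n≤o⇒m≤o (ir′ + is′) v≤))))))))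
      where
      e₁ : ∀ a b c d e f g h → ((a + b) + (c + d)) + ((e + f) + (g + h)) ≡ ((a + b) + (e + f)) + ((c + d) + (g + h))
      e₁ = ℕ-solve-∀
      e₂ : ∀ a b c d e f g h → ((a + b) + (c + d)) + ((e + f) + (g + h)) ≡ ((a + c) + (e + g)) + ((b + d) + (f + h))
      e₂ = ℕ-solve-∀

    ∈-allTuples : ∀ {fs} → MonicTuple ds fs → fs ∈ allTuples n
    ∈-allTuples {fs} Ms =
      ∈-concatMap {f = tuplesAt₁ n} {x = x} (∈-upTo⁺ (s≤s x≤n))
        (∈-concatMap {f = tuplesAt₂ n x} {x = y} (∈-upTo⁺ (s≤s y≤n))
          (∈-concatMap {f = tuples n x y} {xs = degreeData n x y} {x = datum} ∈-degreeData
            (∈-guarded {ds = degrees n x y datum} sum-degrees (subst (λ v → fs ∈ monicTuples v) (sym degrees-datum) (∈-monicTuples Ms)))))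
      where
      x≤n : x ≤ n
      x≤n = ℕ.m∸n≤m n ((ir + is) + (it + iw))
      y≤n : y ≤ n
      y≤n = ℕ.m∸n≤m n ((ir′ + is′) + (it′ + iw′))

  ∈-equalTriples⁻ : ∀ {n z z′ z″} → (z , (z′ , z″)) ∈ equalTriples n →
    MonicPair n z × MonicPair n z′ × MonicPair n z″ × prod z ≡ prod z′ × prod z ≡ prod z″
  ∈-equalTriples⁻ {n} {z} x∈
    with z∈ , zs∈ ← sigma-∈ {xs = pairs F n} {f = λ z → factorisationPairs n (prod z)} x∈
    with z′∈ , z″∈ ← ∈-cartesianProduct⁻ (factorisations n (prod z)) (factorisations n (prod z)) zs∈
    with z′∈ , e′ ← factorisations-∈ {n} z′∈ | z″∈ , e″ ← factorisations-∈ {n} z″∈ =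
    pairs-∈ {n} z∈ , pairs-∈ {n} z′∈ , pairs-∈ {n} z″∈ , e′ , e″

  combined : ∀ {n z z′ z″} → MonicPair n z → MonicPair n z′ → MonicPair n z″ → Cube z z′ z″ →
             ∃[ fs ] fs ∈ allTuples n × (z , (z′ , z″)) ≡ combine fs
  combined {n} (monicPair U V u≤ v≤) (monicPair U′ V′ u′≤ v′≤) (monicPair U″ V″ u″≤ v″≤)
    record { R = R ; S = S ; T = T ; W = W ; R′ = R′ ; S′ = S′ ; T′ = T′ ; W′ = W′ ; combines = refl } =
    _ , ∈-allTuples
          (bound U R S T W u≤) (bound V R′ S′ T′ W′ v≤) (bound U′ R S R′ S′ u′≤)
          (bound V′ T W T′ W′ v′≤) (bound U″ R T R′ T′ u″≤) (bound V″ S W S′ W′ v″≤)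
          (R ∷ S ∷ T ∷ W ∷ R′ ∷ S′ ∷ T′ ∷ W′ ∷ [])
      , refl
    where
    bound : ∀ {d i j k l f g h e} → Monic d ((f ⊠ g) ⊠ (h ⊠ e)) →
            Monic i f → Monic j g → Monic k h → Monic l e → d ≤ n → (i + j) + (k + l) ≤ n
    bound M A B C D d≤n =
      subst (_≤ n) (Monic-degree M (Monic-⊠ (Monic-⊠ A B) (Monic-⊠ C D))) d≤n

  ΣΦ²≤∣allTuples∣ : ∀ n → ΣΦ² n ≤ length (allTuples n)
  ΣΦ²≤∣allTuples∣ n = subst (_≤ length (allTuples n)) (length-equalTriples n)
    (length-≤ {R = λ x fs → x ≡ combine fs} (equalTriples n) (allTuples n) (Unique-equalTriples n)
      (λ x∈ → let Z , Z′ , Z″ , e′ , e″ = ∈-equalTriples⁻ {n} x∈ in combined Z Z′ Z″ (cube Z Z′ Z″ e′ e″))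
      (λ _ _ e e′ → trans e (sym e′)))

  -- Second moment: summation over the defects of u and v.

  -- The share of one of u, v when its defect is x: q^(n-x) for its factors, and (1+x)² towards the
  -- (1+x+y)² choices for the defects of u′ and u″.
  weight : ℕ → ℕ → ℕ
  weight n x = suc x * suc x * q ^ (n ∸ x)

  -- The potential m² + 6m + 11 is the tail Σ_{i ≥ 1} (m + 1 + i)² 2^{-i}.
  weights-≤ : ∀ m k → sum (map (weight (m + k)) (upTo (suc m))) + (m * m + 6 * m + 11) * q ^ k
                      ≤ 12 * q ^ (m + k)
  weights-≤ zero    k = ℕ.≤-reflexive (base (q ^ k))
    where
    base : ∀ Q → (1 * Q + 0) + 11 * Q ≡ 12 * Q
    base = ℕ-solve-∀
  weights-≤ (suc m) k = begin
    sum (map w (upTo (suc (suc m)))) + φ (suc m) * q ^ k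
      ≡⟨ cong (_+ φ (suc m) * q ^ k) (sum-upTo-suc w (suc m)) ⟩
    sum (map w (upTo (suc m))) + suc (suc m) * suc (suc m) * q ^ (suc m + k ∸ suc m) + φ (suc m) * q ^ k
      ≡⟨ cong (λ e → sum (map w (upTo (suc m))) + suc (suc m) * suc (suc m) * q ^ e + φ (suc m) * q ^ k) (ℕ.m+n∸m≡n (suc m) k) ⟩
    sum (map w (upTo (suc m))) + suc (suc m) * suc (suc m) * q ^ k + φ (suc m) * q ^ k
      ≡⟨ step (sum (map w (upTo (suc m)))) m (q ^ k) ⟩
    sum (map w (upTo (suc m))) + φ m * (2 * q ^ k)
      ≤⟨ ℕ.+-monoʳ-≤ (sum (map w (upTo (suc m)))) (ℕ.*-monoʳ-≤ (φ m) (ℕ.*-monoˡ-≤ (q ^ k) 1<q)) ⟩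
    sum (map w (upTo (suc m))) + φ m * q ^ suc k
      ≡⟨ cong (λ e → sum (map (weight e) (upTo (suc m))) + φ m * q ^ suc k) (ℕ.+-suc m k) ⟨
    sum (map (weight (m + suc k)) (upTo (suc m))) + φ m * q ^ suc k
      ≤⟨ weights-≤ m (suc k) ⟩
    12 * q ^ (m + suc k)
      ≡⟨ cong (λ e → 12 * q ^ e) (ℕ.+-suc m k) ⟩
    12 * q ^ (suc m + k) ∎
    where
    open ℕ.≤-Reasoning
    w = weight (suc m + k)
    φ : ℕ → ℕ
    φ m = m * m + 6 * m + 11
    step : ∀ s m Q → s + suc (suc m) * suc (suc m) * Q + (suc m * suc m + 6 * suc m + 11) * Q
                   ≡ s + (m * m + 6 * m + 11) * (2 * Q)
    step = ℕ-solve-∀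

  Σweight≤ : ∀ n → sum (map (weight n) (upTo (suc n))) ≤ 12 * q ^ n
  Σweight≤ n = subst (λ e → sum (map (weight e) (upTo (suc n))) ≤ 12 * q ^ e) (ℕ.+-identityʳ n)
    (ℕ.≤-trans (ℕ.m≤m+n _ _) (weights-≤ n 0))

  -- The inequality 1 + x + y ≤ (1+x)(1+y) separates the two defects, so that the double sum splits
  -- into two single ones.
  tuplesAt₂-≤ : ∀ n x y → length (tuplesAt₂ n x y) ≤ suc n ^ 4 * weight n x * weight n y
  tuplesAt₂-≤ n x y = begin
    length (tuplesAt₂ n x y)
      ≤⟨ length-concatMap-≤ {f = tuples n x y} {w = λ _ → 1} {K = q ^ (a + b)} (degreeData n x y)
           (λ {c} _ → subst (length (tuples n x y c) ≤_) (sym (ℕ.*-identityʳ _)) (length-guarded (a + b) (degrees n x y c))) ⟩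
    q ^ (a + b) * sum (map (λ _ → 1) (degreeData n x y))
      ≡⟨ cong₂ _*_ (ℕ.^-distribˡ-+-* q a b) (trans (sum-map-const 1 (degreeData n x y)) (trans (ℕ.*-identityʳ _) (length-degreeData n x y))) ⟩
    q ^ a * q ^ b * (suc (x + y) * (suc (x + y) * (suc n * (suc n * (suc n * suc n)))))
      ≡⟨ step₁ (q ^ a) (q ^ b) (suc (x + y)) (suc n) ⟩
    q ^ a * q ^ b * (suc n ^ 4) * (suc (x + y) * suc (x + y))
      ≤⟨ ℕ.*-monoʳ-≤ (q ^ a * q ^ b * (suc n ^ 4)) (ℕ.*-mono-≤ (defects x y) (defects x y)) ⟩
    q ^ a * q ^ b * (suc n ^ 4) * (suc x * suc y * (suc x * suc y))
      ≡⟨ step₂ (q ^ a) (q ^ b) (suc n ^ 4) (suc x) (suc y) ⟩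
    suc n ^ 4 * weight n x * weight n y ∎
    where
    open ℕ.≤-Reasoning
    a = n ∸ x
    b = n ∸ y
    defects : ∀ x y → suc (x + y) ≤ suc x * suc y
    defects x y = ℕ.≤-trans (ℕ.m≤m+n (suc (x + y)) (x * y)) (ℕ.≤-reflexive (expand x y))
      where
      expand : ∀ x y → suc (x + y) + x * y ≡ suc x * suc y
      expand = ℕ-solve-∀
    step₁ : ∀ A B d m → A * B * (d * (d * (m * (m * (m * m))))) ≡ A * B * (m * (m * (m * (m * 1)))) * (d * d)
    step₁ = ℕ-solve-∀
    step₂ : ∀ A B K X Y → A * B * K * (X * Y * (X * Y)) ≡ K * (X * X * A) * (Y * Y * B)
    step₂ = ℕ-solve-∀

  ∣allTuples∣≤ : ∀ n → length (allTuples n) ≤ 144 * suc n ^ 4 * (q ^ n * q ^ n)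
  ∣allTuples∣≤ n = begin
    length (allTuples n)
      ≤⟨ length-concatMap-≤ {f = tuplesAt₁ n} {w = weight n} {K = suc n ^ 4 * (12 * q ^ n)} is (λ {x} _ → at x) ⟩
    suc n ^ 4 * (12 * q ^ n) * sum (map (weight n) is)
      ≤⟨ ℕ.*-monoʳ-≤ (suc n ^ 4 * (12 * q ^ n)) (Σweight≤ n) ⟩
    suc n ^ 4 * (12 * q ^ n) * (12 * q ^ n)              ≡⟨ step₁ (suc n ^ 4) (q ^ n) ⟩
    144 * suc n ^ 4 * (q ^ n * q ^ n)                    ∎
    where
    open ℕ.≤-Reasoning
    is = upTo (suc n)
    step₁ : ∀ K Q → K * (12 * Q) * (12 * Q) ≡ 144 * K * (Q * Q)
    step₁ = ℕ-solve-∀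
    step₂ : ∀ K w s → K * w * s ≡ K * s * w
    step₂ = ℕ-solve-∀
    at : ∀ x → length (tuplesAt₁ n x) ≤ suc n ^ 4 * (12 * q ^ n) * weight n x
    at x = begin
      length (tuplesAt₁ n x)
        ≤⟨ length-concatMap-≤ {f = tuplesAt₂ n x} {w = weight n} {K = suc n ^ 4 * weight n x} is (λ {y} _ → tuplesAt₂-≤ n x y) ⟩
      suc n ^ 4 * weight n x * sum (map (weight n) is)
        ≤⟨ ℕ.*-monoʳ-≤ (suc n ^ 4 * weight n x) (Σweight≤ n) ⟩
      suc n ^ 4 * weight n x * (12 * q ^ n)
        ≡⟨ step₂ (suc n ^ 4) (weight n x) (12 * q ^ n) ⟩
      suc n ^ 4 * (12 * q ^ n) * weight n x               ∎

  ΣΦ²≤ : ∀ n → 1 ≤ n → ΣΦ² n ≤ 2304 * n ^ 4 * (N n * N n)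
  ΣΦ²≤ n 1≤n = begin
    ΣΦ² n                                   ≤⟨ ΣΦ²≤∣allTuples∣ n ⟩
    length (allTuples n)                    ≤⟨ ∣allTuples∣≤ n ⟩
    144 * suc n ^ 4 * (q ^ n * q ^ n)
      -- The assumption n ≥ 1 gives n + 1 ≤ 2n; and q^n, which counts the monic polynomials of
      -- degree exactly n, is at most `N n`.
      ≤⟨ ℕ.*-mono-≤ (ℕ.*-monoʳ-≤ 144 (ℕ.^-monoˡ-≤ 4 (ℕ.+-monoˡ-≤ n 1≤n))) (ℕ.*-mono-≤ q^≤N q^≤N) ⟩
    144 * (n + n) ^ 4 * (N n * N n)         ≡⟨ cong (_* (N n * N n)) (step n) ⟩
    2304 * n ^ 4 * (N n * N n)              ∎
    where
    open ℕ.≤-Reasoning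
    q^≤N : q ^ n ≤ N n
    q^≤N = ℕ.≤-trans (ℕ.m≤n+m (q ^ n) (∣B∣ n)) (ℕ.≤-reflexive (sym (∣B∣-suc n)))
    step : ∀ n → 144 * ((n + n) * ((n + n) * ((n + n) * ((n + n) * 1)))) ≡ 2304 * (n * (n * (n * (n * 1))))
    step = ℕ-solve-∀

-- Transfer of estimates from ℕ to ℚ.

module Rationals where
  open import Data.Nat using (NonZero)
  open import Data.Integer using (+_)
  open import Data.Rational using (ℚ; _/_; _+_; _*_; _-_; -_; ∣_∣; 0ℚ; toℚᵘ) renaming (_≤_ to _≤ℚ_)
  open RingProperties ℚ.+-*-ring using (x[y-z]≈xy-xz; ⁻¹-anti-homo‿-)

  -- Division in ℚ reduces to lowest terms, which does not compute for variable arguments; the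
  -- identities below are therefore checked on unnormalised fractions.
  toℚᵘ-/ : ∀ S d → toℚᵘ (+ S / suc d) ℚᵘ.≃ ℚᵘ.mkℚᵘ (+ S) d
  toℚᵘ-/ S d = ℚ.toℚᵘ-fromℚᵘ (ℚᵘ.mkℚᵘ (+ S) d)

  ℕ→ℚ-* : ∀ a b → ℕ→ℚ (a ℕ.* b) ≡ ℕ→ℚ a * ℕ→ℚ b
  ℕ→ℚ-* a b = ℚ.toℚᵘ-injective (begin-equality
    toℚᵘ (ℕ→ℚ (a ℕ.* b))                       ≃⟨ toℚᵘ-/ (a ℕ.* b) 0 ⟩
    ℚᵘ.mkℚᵘ (+ (a ℕ.* b)) 0                    ≡⟨ cong (λ z → ℚᵘ.mkℚᵘ z 0) (ℤ.pos-* a b) ⟩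
    ℚᵘ.mkℚᵘ (+ a) 0 ℚᵘ.* ℚᵘ.mkℚᵘ (+ b) 0       ≃⟨ ℚᵘ.*-cong (toℚᵘ-/ a 0) (toℚᵘ-/ b 0) ⟨
    toℚᵘ (ℕ→ℚ a) ℚᵘ.* toℚᵘ (ℕ→ℚ b)             ≃⟨ ℚ.toℚᵘ-homo-* (ℕ→ℚ a) (ℕ→ℚ b) ⟨
    toℚᵘ (ℕ→ℚ a * ℕ→ℚ b)                       ∎)
    where open ℚᵘ.≤-Reasoning

  ℕ→ℚ-+ : ∀ a b → ℕ→ℚ (a ℕ.+ b) ≡ ℕ→ℚ a + ℕ→ℚ b
  ℕ→ℚ-+ a b = ℚ.toℚᵘ-injective (begin-equality
    toℚᵘ (ℕ→ℚ (a ℕ.+ b))                       ≃⟨ toℚᵘ-/ (a ℕ.+ b) 0 ⟩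
    ℚᵘ.mkℚᵘ (+ (a ℕ.+ b)) 0
      ≡⟨ cong (λ z → ℚᵘ.mkℚᵘ z 0) (cong₂ ℤ._+_ (ℤ.*-identityʳ (+ a)) (ℤ.*-identityʳ (+ b))) ⟨
    ℚᵘ.mkℚᵘ (+ a) 0 ℚᵘ.+ ℚᵘ.mkℚᵘ (+ b) 0       ≃⟨ ℚᵘ.+-cong (toℚᵘ-/ a 0) (toℚᵘ-/ b 0) ⟨
    toℚᵘ (ℕ→ℚ a) ℚᵘ.+ toℚᵘ (ℕ→ℚ b)             ≃⟨ ℚ.toℚᵘ-homo-+ (ℕ→ℚ a) (ℕ→ℚ b) ⟨
    toℚᵘ (ℕ→ℚ a + ℕ→ℚ b)                       ∎)
    where open ℚᵘ.≤-Reasoning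

  ℕ→ℚ-mono : ∀ {a b} → a ℕ.≤ b → ℕ→ℚ a ≤ℚ ℕ→ℚ b
  ℕ→ℚ-mono {a} {b} a≤b = ℚ.toℚᵘ-cancel-≤ (begin
    toℚᵘ (ℕ→ℚ a)       ≃⟨ toℚᵘ-/ a 0 ⟩
    ℚᵘ.mkℚᵘ (+ a) 0    ≤⟨ ℚᵘ.*≤* (ℤ.*-monoʳ-≤-nonNeg (+ 1) (ℤ.+≤+ a≤b)) ⟩
    ℚᵘ.mkℚᵘ (+ b) 0    ≃⟨ toℚᵘ-/ b 0 ⟨
    toℚᵘ (ℕ→ℚ b)       ∎)
    where open ℚᵘ.≤-Reasoning

  /-*-cancel : ∀ S N .{{_ : NonZero N}} → (+ S / N) * ℕ→ℚ N ≡ ℕ→ℚ S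
  /-*-cancel S (suc d) = ℚ.toℚᵘ-injective (begin-equality
    toℚᵘ ((+ S / suc d) * ℕ→ℚ (suc d))                  ≃⟨ ℚ.toℚᵘ-homo-* (+ S / suc d) (ℕ→ℚ (suc d)) ⟩
    toℚᵘ (+ S / suc d) ℚᵘ.* toℚᵘ (ℕ→ℚ (suc d))          ≃⟨ ℚᵘ.*-cong (toℚᵘ-/ S d) (toℚᵘ-/ (suc d) 0) ⟩
    ℚᵘ.mkℚᵘ (+ S) d ℚᵘ.* ℚᵘ.mkℚᵘ (+ suc d) 0
      ≃⟨ ℚᵘ.*≡* (trans (ℤ.*-identityʳ _) (cong (λ e → + S ℤ.* + e) (sym (ℕ.*-identityʳ (suc d))))) ⟩
    ℚᵘ.mkℚᵘ (+ S) 0                                     ≃⟨ toℚᵘ-/ S 0 ⟨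
    toℚᵘ (ℕ→ℚ S)                                        ∎)
    where open ℚᵘ.≤-Reasoning

  scaled-/ : ∀ a S N .{{_ : NonZero N}} → ℕ→ℚ a * (+ S / N) * ℕ→ℚ N ≡ ℕ→ℚ (a ℕ.* S)
  scaled-/ a S N = trans (ℚ.*-assoc (ℕ→ℚ a) (+ S / N) (ℕ→ℚ N))
    (trans (cong (ℕ→ℚ a *_) (/-*-cancel S N)) (sym (ℕ→ℚ-* a S)))

  scaled-/-≤ : ∀ a b S N .{{_ : NonZero N}} → a ℕ.* S ℕ.≤ b ℕ.* N → ℕ→ℚ a * (+ S / N) ≤ℚ ℕ→ℚ b
  scaled-/-≤ a b S N le = ℚ.*-cancelʳ-≤-pos (ℕ→ℚ N) {{ℚ.normalize-pos N 1}} (begin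
    ℕ→ℚ a * (+ S / N) * ℕ→ℚ N    ≡⟨ scaled-/ a S N ⟩
    ℕ→ℚ (a ℕ.* S)                ≤⟨ ℕ→ℚ-mono le ⟩
    ℕ→ℚ (b ℕ.* N)                ≡⟨ ℕ→ℚ-* b N ⟩
    ℕ→ℚ b * ℕ→ℚ N                ∎)
    where open ℚ.≤-Reasoning

  -- The error term stays on the larger side, where it needs no subtraction in ℕ.
  scaled-/-≥ : ∀ a b c S N .{{_ : NonZero N}} → b ℕ.* N ℕ.≤ a ℕ.* S ℕ.+ c ℕ.* N →
               ℕ→ℚ b ≤ℚ ℕ→ℚ c + ℕ→ℚ a * (+ S / N)
  scaled-/-≥ a b c S N le = ℚ.*-cancelʳ-≤-pos (ℕ→ℚ N) {{ℚ.normalize-pos N 1}} (begin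
    ℕ→ℚ b * ℕ→ℚ N                                   ≡⟨ ℕ→ℚ-* b N ⟨
    ℕ→ℚ (b ℕ.* N)                                   ≤⟨ ℕ→ℚ-mono le ⟩
    ℕ→ℚ (a ℕ.* S ℕ.+ c ℕ.* N)                       ≡⟨ cong ℕ→ℚ (ℕ.+-comm (a ℕ.* S) (c ℕ.* N)) ⟩
    ℕ→ℚ (c ℕ.* N ℕ.+ a ℕ.* S)                       ≡⟨ ℕ→ℚ-+ (c ℕ.* N) (a ℕ.* S) ⟩
    ℕ→ℚ (c ℕ.* N) + ℕ→ℚ (a ℕ.* S)                   ≡⟨ cong₂ _+_ (ℕ→ℚ-* c N) (sym (scaled-/ a S N)) ⟩
    ℕ→ℚ c * ℕ→ℚ N + ℕ→ℚ a * (+ S / N) * ℕ→ℚ N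
      ≡⟨ ℚ.*-distribʳ-+ (ℕ→ℚ N) (ℕ→ℚ c) (ℕ→ℚ a * (+ S / N)) ⟨
    (ℕ→ℚ c + ℕ→ℚ a * (+ S / N)) * ℕ→ℚ N             ∎)
    where open ℚ.≤-Reasoning

  ≤+⇒-≤ : ∀ {a b c} → a ≤ℚ c + b → a - b ≤ℚ c
  ≤+⇒-≤ {a} {b} {c} le = begin
    a - b            ≤⟨ ℚ.+-monoˡ-≤ (- b) le ⟩
    c + b - b        ≡⟨ ℚ.+-assoc c b (- b) ⟩
    c + (b - b)      ≡⟨ cong (_+_ c) (ℚ.+-inverseʳ b) ⟩
    c + 0ℚ           ≡⟨ ℚ.+-identityʳ c ⟩
    c                ∎
    where open ℚ.≤-Reasoning

  *∣-∣≤ : ∀ {a x y c} → a * x ≤ℚ c + a * y → a * y ≤ℚ c + a * x → a * ∣ x - y ∣ ≤ℚ c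
  *∣-∣≤ {a} {x} {y} {c} le ge with ℚ.∣p∣≡p∨∣p∣≡-p (x - y)
  ... | inj₁ e = subst (_≤ℚ c) (sym (trans (cong (a *_) e) (x[y-z]≈xy-xz a x y))) (≤+⇒-≤ le)
  ... | inj₂ e = subst (_≤ℚ c) (sym (trans (cong (a *_) (trans e (⁻¹-anti-homo‿- x y))) (x[y-z]≈xy-xz a y x)))
                   (≤+⇒-≤ ge)

  a-x²≤a : ∀ a S N .{{_ : NonZero N}} → a - (+ S / N) * (+ S / N) ≤ℚ a
  a-x²≤a a S N = ≤+⇒-≤ (begin
    a                ≡⟨ ℚ.+-identityʳ a ⟨
    a + 0ℚ
      ≤⟨ ℚ.+-monoʳ-≤ a (ℚ.nonNegative⁻¹ (x * x) {{ℚ.nonNeg*nonNeg⇒nonNeg x {{x≥0}} x {{x≥0}}}}) ⟩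
    a + x * x        ∎)
    where
    open ℚ.≤-Reasoning
    x = + S / N
    x≥0 : ℚ.NonNegative x
    x≥0 = ℚ.normalize-nonNeg S N

-- The bounds for expectation and variance.

open import Data.Rational using (ℚ; ∣_∣; _-_; _*_) renaming (_≤_ to _≤ℚ_)

-- Divided by q, the bound says that the expectation differs from n + 1 by at most 4 (n+1)/q, which
-- is the relative error O(1/q) with an absolute constant.
expectation-bound : (F : FiniteField) (n : ℕ) →
  ℕ→ℚ (FiniteField.q F) * ∣ expectΦ F n - ℕ→ℚ (suc n) ∣ ≤ℚ ℕ→ℚ (4 ℕ.* suc n)
expectation-bound F n = *∣-∣≤ {ℕ→ℚ q} {expectΦ F n} {ℕ→ℚ (suc n)} {ℕ→ℚ (4 ℕ.* suc n)}
  (subst (ℕ→ℚ q * expectΦ F n ≤ℚ_)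
    (trans (ℕ→ℚ-+ (4 ℕ.* suc n) (q ℕ.* suc n)) (cong (ℚ._+_ (ℕ→ℚ (4 ℕ.* suc n))) (ℕ→ℚ-* q (suc n))))
    -- The denominator `N² F n` unfolds to `N n ℕ.* N n`, the scale of the estimates in ℕ.
    (scaled-/-≤ q (4 ℕ.* suc n ℕ.+ q ℕ.* suc n) (ΣΦ n) (N² F n)
      (subst (λ m → q ℕ.* ΣΦ n ≤ m ℕ.* (N n ℕ.* N n)) (regroup q (suc n)) (qΣΦ≤ n))))
  (subst (_≤ℚ ℕ→ℚ (4 ℕ.* suc n) ℚ.+ ℕ→ℚ q * expectΦ F n) (ℕ→ℚ-* q (suc n))
    (scaled-/-≥ q (q ℕ.* suc n) (4 ℕ.* suc n) (ΣΦ n) (N² F n) (qΣΦ≥ n)))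
  where
  open FiniteField F using (q)
  open MonicLists F
  open FirstMoment F
  open Rationals
  regroup : ∀ q m → (q ℕ.+ 4) ℕ.* m ≡ 4 ℕ.* m ℕ.+ q ℕ.* m
  regroup = ℕ-solve-∀

variance-bound : (F : FiniteField) (n : ℕ) → 1 ≤ n → varΦ F n ≤ℚ ℕ→ℚ (2304 ℕ.* n ^ 4)
variance-bound F n 1≤n = ℚ.≤-trans (a-x²≤a (expectΦ² F n) (ΣΦ n) (N² F n))
  (subst (_≤ℚ ℕ→ℚ (2304 ℕ.* n ^ 4)) (ℚ.*-identityˡ (expectΦ² F n))
    (scaled-/-≤ 1 (2304 ℕ.* n ^ 4) (ΣΦ² n) (N² F n)
      (subst (_≤ 2304 ℕ.* n ^ 4 ℕ.* (N n ℕ.* N n)) (sym (ℕ.*-identityˡ (ΣΦ² n))) (ΣΦ²≤ n 1≤n))))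
  where
  open MonicLists F
  open FirstMoment F
  open SecondMoment F
  open Rationals

theorem5 : ∃[ C ] ∃[ D ] ((F : FiniteField) (n : ℕ) → 1 ≤ n →
    ((ℕ→ℚ (FiniteField.q F) * ∣ expectΦ F n - ℕ→ℚ (suc n) ∣ ≤ℚ ℕ→ℚ (C Data.Nat.* suc n))
    × (varΦ F n ≤ℚ ℕ→ℚ (D Data.Nat.* n ^ 4))))
theorem5 = 4 , 2304 , λ F n 1≤n → expectation-bound F n , variance-bound F n 1≤n
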